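{- There is no computable binary relation $\mathrel{\epsilon}$ on $\mathbb N$ and equivalence relation $E$ on $\mathbb N$ (of any complexity) which is a congruence with respect to $\mathrel{\epsilon}$, such that the quotient $\langle\mathbb N,\mathrel{\epsilon}\rangle/E$ is a model of ZFC. Indeed, no such quotient is a model of Kripke–Platek set theory KP.
   Context: $E$ is a congruence with respect to $\mathrel{\epsilon}$ if $x\,E\,x'$ and $y\,E\,y'$ imply ($x\mathrel{\epsilon} y\iff x'\mathrel{\epsilon} y'$); the quotient structure then interprets set membership. No assumption is made on whether the quotient model is well-founded.
   Formalization: Kripke–Platek set theory KP is taken to include the axiom of Infinity; without it the claim fails, since the hereditarily finite sets under Ackermann's computable membership relation on the natural numbers, with equality as E, form a model. -}

module Defs where

open import Data.Nat using (ℕ; zero; suc; _<_)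
open import Data.Fin using (Fin; zero; suc; #_)
open import Data.Vec using (Vec; []; _∷_; lookup)
open import Data.Bool using (Bool; true; false; if_then_else_)
open import Data.Product using (Σ; _×_; _,_)
open import Data.Empty using (⊥)
open import Relation.Nullary using (¬_)
open import Relation.Binary.PropositionalEquality using (_≡_)
open import Relation.Binary.Structures using (IsEquivalence)

data PR : ℕ → Set where
  zeroᵖ : ∀ {n} → PR n
  succᵖ : PR 1
  projᵖ : ∀ {n} → Fin n → PR n
  compᵖ : ∀ {m n} → PR m → Vec (PR n) m → PR n
  recᵖ  : ∀ {n} → PR n → PR (suc (suc n)) → PR (suc n)
  μᵖ    : ∀ {n} → PR (suc n) → PR n

mutual
  data Eval : ∀ {n} → PR n → Vec ℕ n → ℕ → Set where
    e-zero : ∀ {n} {xs : Vec ℕ n} → Eval zeroᵖ xs 0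
    e-succ : ∀ {x} → Eval succᵖ (x ∷ []) (suc x)
    e-proj : ∀ {n} {i : Fin n} {xs} → Eval (projᵖ i) xs (lookup xs i)
    e-comp : ∀ {m n} {f : PR m} {gs : Vec (PR n) m} {xs ys y} →
             EvalAll gs xs ys → Eval f ys y → Eval (compᵖ f gs) xs y
    e-rec0 : ∀ {n} {g : PR n} {h xs y} →
             Eval g xs y → Eval (recᵖ g h) (0 ∷ xs) y
    e-recS : ∀ {n} {g : PR n} {h k xs r y} →
             Eval (recᵖ g h) (k ∷ xs) r → Eval h (k ∷ r ∷ xs) y →
             Eval (recᵖ g h) (suc k ∷ xs) y
    e-μ    : ∀ {n} {f : PR (suc n)} {xs k} →
             Eval f (k ∷ xs) 0 →
             (∀ j → j < k → Σ ℕ (λ v → Eval f (j ∷ xs) (suc v))) →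
             Eval (μᵖ f) xs k

  data EvalAll : ∀ {m n} → Vec (PR n) m → Vec ℕ n → Vec ℕ m → Set where
    []  : ∀ {n} {xs : Vec ℕ n} → EvalAll [] xs []
    _∷_ : ∀ {m n} {g : PR n} {gs : Vec (PR n) m} {xs y ys} →
          Eval g xs y → EvalAll gs xs ys → EvalAll (g ∷ gs) xs (y ∷ ys)

Computable₂ : (ℕ → ℕ → Bool) → Set
Computable₂ R = Σ (PR 2) λ c → ∀ x y → Eval c (x ∷ y ∷ []) (if R x y then 1 else 0)

-- First-order formulas in the language {∈, =}, de Bruijn variables.
-- ball i φ  is  ∀x ∈ vᵢ. φ   and  bex i φ  is  ∃x ∈ vᵢ. φ  (x = variable 0 of φ).

data Formula (n : ℕ) : Set where
  mem eql  : Fin n → Fin n → Formula n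
  fls      : Formula n
  and or imp : Formula n → Formula n → Formula n
  all ex   : Formula (suc n) → Formula n
  ball bex : Fin n → Formula (suc n) → Formula n

neg : ∀ {n} → Formula n → Formula n
neg φ = imp φ fls

tru : ∀ {n} → Formula n
tru = imp fls fls

iff : ∀ {n} → Formula n → Formula n → Formula n
iff φ ψ = and (imp φ ψ) (imp ψ φ)

data IsΔ₀ {n : ℕ} : Formula n → Set where
  d-mem  : ∀ i j → IsΔ₀ (mem i j)
  d-eql  : ∀ i j → IsΔ₀ (eql i j)
  d-fls  : IsΔ₀ fls
  d-and  : ∀ {φ ψ} → IsΔ₀ φ → IsΔ₀ ψ → IsΔ₀ (and φ ψ)
  d-or   : ∀ {φ ψ} → IsΔ₀ φ → IsΔ₀ ψ → IsΔ₀ (or φ ψ)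
  d-imp  : ∀ {φ ψ} → IsΔ₀ φ → IsΔ₀ ψ → IsΔ₀ (imp φ ψ)
  d-ball : ∀ i {φ} → IsΔ₀ φ → IsΔ₀ (ball i φ)
  d-bex  : ∀ i {φ} → IsΔ₀ φ → IsΔ₀ (bex i φ)

ext : ∀ {n m} → (Fin n → Fin m) → Fin (suc n) → Fin (suc m)
ext r zero    = zero
ext r (suc i) = suc (r i)

rename : ∀ {n m} → (Fin n → Fin m) → Formula n → Formula m
rename r (mem i j) = mem (r i) (r j)
rename r (eql i j) = eql (r i) (r j)
rename r fls       = fls
rename r (and φ ψ) = and (rename r φ) (rename r ψ)
rename r (or φ ψ)  = or (rename r φ) (rename r ψ)
rename r (imp φ ψ) = imp (rename r φ) (rename r ψ)
rename r (all φ)   = all (rename (ext r) φ)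
rename r (ex φ)    = ex (rename (ext r) φ)
rename r (ball i φ) = ball (r i) (rename (ext r) φ)
rename r (bex i φ)  = bex (r i) (rename (ext r) φ)

keep1 : ∀ {n} j → Fin (suc n) → Fin (suc (j Data.Nat.+ n))
keep1 j zero    = zero
keep1 j (suc i) = suc (j Data.Fin.↑ʳ i)

keep2 : ∀ {n} j → Fin (suc (suc n)) → Fin (suc (suc (j Data.Nat.+ n)))
keep2 j = ext (keep1 j)

-- Satisfaction in the structure ⟨ℕ, Mem⟩ with equality interpreted by
-- Eq (for a congruence Eq this is satisfaction in the quotient ⟨ℕ,Mem⟩/Eq).
-- Classical (Tarskian) semantics, rendered via the Gödel–Gentzen
-- negative translation: ∃ = ¬∀¬, ∨ = ¬(¬∧¬), atoms double-negated.

_∷ᵉ_ : ∀ {n} → ℕ → (Fin n → ℕ) → Fin (suc n) → ℕ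
(a ∷ᵉ ρ) zero    = a
(a ∷ᵉ ρ) (suc i) = ρ i

module _ (Mem Eq : ℕ → ℕ → Set) where
  Sat : ∀ {n} → (Fin n → ℕ) → Formula n → Set
  Sat ρ (mem i j) = ¬ ¬ Mem (ρ i) (ρ j)
  Sat ρ (eql i j) = ¬ ¬ Eq (ρ i) (ρ j)
  Sat ρ fls       = ⊥
  Sat ρ (and φ ψ) = Sat ρ φ × Sat ρ ψ
  Sat ρ (or φ ψ)  = ¬ (¬ Sat ρ φ × ¬ Sat ρ ψ)
  Sat ρ (imp φ ψ) = Sat ρ φ → Sat ρ ψ
  Sat ρ (all φ)   = ∀ a → Sat (a ∷ᵉ ρ) φ
  Sat ρ (ex φ)    = ¬ (∀ a → ¬ Sat (a ∷ᵉ ρ) φ)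
  Sat ρ (ball i φ) = ∀ a → ¬ ¬ Mem a (ρ i) → Sat (a ∷ᵉ ρ) φ
  Sat ρ (bex i φ)  = ¬ (∀ a → ¬ ¬ Mem a (ρ i) → ¬ Sat (a ∷ᵉ ρ) φ)

-- Axioms (a formula with n free variables stands for its universal closure).

Ax-Ext : Formula 0
Ax-Ext = all (all (imp (all (iff (mem (# 0) (# 2)) (mem (# 0) (# 1)))) (eql (# 1) (# 0))))

Ax-Found : ∀ {n} → Formula (suc n) → Formula n
Ax-Found φ = imp (ex φ) (ex (and φ (ball (# 0) (neg (rename (keep1 1) φ)))))

Ax-Reg : Formula 0
Ax-Reg = all (imp (bex (# 0) tru) (bex (# 0) (ball (# 0) (neg (mem (# 0) (# 2))))))

Ax-Pair : Formula 0
Ax-Pair = all (all (ex (and (mem (# 2) (# 0)) (mem (# 1) (# 0)))))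

Ax-Union : Formula 0
Ax-Union = all (ex (ball (# 1) (ball (# 0) (mem (# 0) (# 2)))))

Ax-Inf : Formula 0
Ax-Inf = ex (and (bex (# 0) (ball (# 0) fls))
                 (ball (# 0) (bex (# 1)
                   (and (mem (# 1) (# 0))
                   (and (ball (# 1) (mem (# 0) (# 1)))
                        (ball (# 0) (or (mem (# 0) (# 2)) (eql (# 0) (# 2)))))))))

Ax-Sep : ∀ {n} → Formula (suc n) → Formula n
Ax-Sep φ = all (ex (all (iff (mem (# 0) (# 1))
                             (and (mem (# 0) (# 2)) (rename (keep1 2) φ)))))

Ax-Coll : ∀ {n} → Formula (suc (suc n)) → Formula n
Ax-Coll φ = all (imp (ball (# 0) (ex (rename (keep2 1) φ)))
                     (ex (ball (# 1) (bex (# 1) (rename (keep2 2) φ)))))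

-- Replacement scheme (φ(y, x, params)):
--   ∀a (∀x∈a ∃y (φ(x,y) ∧ ∀y' (φ(x,y') → y' = y)) → ∃b ∀x∈a ∃y∈b φ(x,y))
-- inside ∀y' the context is y', y, x, a, params; φ(x,y') needs y ↦ 0, x ↦ 2
keepR : ∀ {n} → Fin (suc (suc n)) → Fin (suc (suc (suc (suc n))))
keepR zero          = zero
keepR (suc zero)    = suc (suc zero)
keepR (suc (suc i)) = suc (suc (suc (suc i)))

Ax-Repl : ∀ {n} → Formula (suc (suc n)) → Formula n
Ax-Repl φ = all (imp (ball (# 0) (ex (and (rename (keep2 1) φ)
                       (all (imp (rename keepR φ) (eql (# 0) (# 1)))))))
                     (ex (ball (# 1) (bex (# 1) (rename (keep2 2) φ)))))

Ax-Pow : Formula 0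
Ax-Pow = all (ex (all (imp (ball (# 0) (mem (# 0) (# 3))) (mem (# 0) (# 1)))))

Ax-Choice : Formula 0
Ax-Choice = all (imp (and (ball (# 0) (bex (# 0) tru))
                          (ball (# 0) (ball (# 1) (imp (neg (eql (# 1) (# 0)))
                                                      (ball (# 1) (neg (mem (# 0) (# 1))))))))
                     (ex (ball (# 1) (bex (# 0)
                        (and (mem (# 0) (# 2))
                             (ball (# 1) (imp (mem (# 0) (# 3)) (eql (# 0) (# 1)))))))))

-- Kripke–Platek set theory with infinity (KP, as in the paper; cf. Barwise):
-- Extensionality, Foundation scheme, Pairing, Union, Infinity,
-- Δ₀-Separation, Δ₀-Collection.
data KP : ∀ {n} → Formula n → Set where
  kp-ext   : KP Ax-Ext
  kp-found : ∀ {n} (φ : Formula (suc n)) → KP (Ax-Found φ)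
  kp-pair  : KP Ax-Pair
  kp-union : KP Ax-Union
  kp-inf   : KP Ax-Inf
  kp-sep   : ∀ {n} (φ : Formula (suc n)) → IsΔ₀ φ → KP (Ax-Sep φ)
  kp-coll  : ∀ {n} (φ : Formula (suc (suc n))) → IsΔ₀ φ → KP (Ax-Coll φ)

data ZFC : ∀ {n} → Formula n → Set where
  zfc-ext    : ZFC Ax-Ext
  zfc-reg    : ZFC Ax-Reg
  zfc-pair   : ZFC Ax-Pair
  zfc-union  : ZFC Ax-Union
  zfc-inf    : ZFC Ax-Inf
  zfc-sep    : ∀ {n} (φ : Formula (suc n)) → ZFC (Ax-Sep φ)
  zfc-repl   : ∀ {n} (φ : Formula (suc (suc n))) → ZFC (Ax-Repl φ)
  zfc-pow    : ZFC Ax-Pow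
  zfc-choice : ZFC Ax-Choice

IsModelOf : (T : ∀ {n} → Formula n → Set) → (Mem Eq : ℕ → ℕ → Set) → Set
IsModelOf T Mem Eq = ∀ {n} (φ : Formula n) → T φ → (ρ : Fin n → ℕ) → Sat Mem Eq ρ φ

IsCongruence : (ε : ℕ → ℕ → Bool) → (E : ℕ → ℕ → Set) → Set
IsCongruence ε E = ∀ {x x′ y y′} → E x x′ → E y y′ →
  (ε x y ≡ true → ε x′ y′ ≡ true) × (ε x′ y′ ≡ true → ε x y ≡ true)

ComputableQuotientModel : (T : ∀ {n} → Formula n → Set) → Set₁
ComputableQuotientModel T =
  Σ (ℕ → ℕ → Bool) λ ε → Σ (ℕ → ℕ → Set) λ E →
    Computable₂ ε × IsEquivalence E × IsCongruence ε E ×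
    IsModelOf T (λ x y → ε x y ≡ true) E

{-# OPTIONS --safe #-}
module Submission where

-- Fix a model with decidable ε. Inside it every partial recursive function is
-- represented by a Δ₀ formula rep with a bounding parameter b: at standard numerals
-- its values are unique, and they exist as soon as b is large enough. Hence every
-- computable set of standard numbers is coded by a set S of the model. In KP,
-- where separation is only Δ₀, the bounds are first collected over a set containing all
-- standard numerals.
--
-- Conversely a representative of the numeral n̄ is computable from n although E is
-- not: let I be an inductive set and D = {{n,{n+1,I}} : n ∈ I}. From n̄ search for d ∈ D
-- with n̄ ∈ d, then for e ∈ d with I ∈ e, then for y ∈ e with y ∈ I; each answer is
-- unique up to E, and y is the next numeral.
--
-- So the set {n : ¬ n̄ ε n} is computable, is coded by some S, and n = S is a contradiction.

open import Defs
open import Data.Bool using (Bool; true; false; _∧_; if_then_else_; _≟_)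
open import Data.Empty using (⊥; ⊥-elim)
open import Data.Fin using (Fin; zero; suc; _↑ʳ_; _↑ˡ_)
open import Data.Nat using (ℕ; zero; suc; _<_; z≤n; s≤s; _+_)
open import Data.Nat.Properties using (m<n⇒m<1+n; n<1+n; m<1+n⇒m<n∨m≡n)
open import Data.Product using (Σ; _×_; _,_; proj₁; proj₂)
open import Data.Sum using (_⊎_; inj₁; inj₂; [_,_]′)
open import Data.Vec using (Vec; []; _∷_; lookup)
open import Data.Vec.Functional using () renaming (_∷_ to _∷ᵗ_)
open import Function using (_∘_; id)
open import Relation.Binary.PropositionalEquality using (_≡_; refl; sym; trans; subst; cong₂)
open import Relation.Binary.Structures using (IsEquivalence)
open import Relation.Nullary using (¬_)
open import Relation.Nullary.Decidable using (decidable-stable)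
open import Relation.Nullary.Negation using (negated-stable; Stable)

private variable
  A B : Set
  n N : ℕ

-- Double negation as a monad, and classical disjunction.

infixl 1 _>>=_
-- The target is an arbitrary negation, so a do-block can directly prove `∈`, `≈`, `∨ᶜ`, `∃ᶜ` or
-- `∃∈`.
_>>=_ : ¬ ¬ A → (A → ¬ B) → ¬ B
(m >>= k) b = m λ a → k a b

return : A → ¬ ¬ A
return a k = k a

infixr 3 _∨ᶜ_
_∨ᶜ_ : Set → Set → Set
A ∨ᶜ B = ¬ (¬ A × ¬ B)

inl : A → A ∨ᶜ B
inl a (¬a , _) = ¬a a

inr : B → A ∨ᶜ B
inr b (_ , ¬b) = ¬b b

∨ᶜ-elim : ∀ {C : Set} → A ∨ᶜ B → (A → ¬ C) → (B → ¬ C) → ¬ C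
∨ᶜ-elim h f g c = h ((λ a → f a c) , λ b → g b c)

pattern v0 = zero
pattern v1 = suc v0
pattern v2 = suc v1
pattern v3 = suc v2

-- Δ₀ formulas for sets, numbers and computations.

emptyF : Fin N → Formula N
emptyF x = ball x fls

-- t = s ∪ {p}
adjF : (s p t : Fin N) → Formula N
adjF s p t = and (ball t (or (mem v0 (suc s)) (eql v0 (suc p))))
                 (and (ball s (mem v0 (suc t))) (mem p t))

sucF : (x y : Fin N) → Formula N
sucF x = adjF x x

upairF : (a b c : Fin N) → Formula N
upairF a b c = and (ball c (or (eql v0 (suc a)) (eql v0 (suc b)))) (and (mem a c) (mem b c))

-- p = {{i},{i,v}}: i belongs to all members of p, one of which is {i}
opairF : (p i v : Fin N) → Formula N
opairF p i v = and (ball p (and (mem (suc i) v0)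
                                (ball v0 (or (eql v0 (2 ↑ʳ i)) (eql v0 (2 ↑ʳ v))))))
                   (and (bex p (ball v0 (eql v0 (2 ↑ʳ i)))) (bex p (mem (suc v) v0)))

opairInF : (s i v : Fin N) → Formula N
opairInF s i v = bex s (opairF v0 (suc i) (suc v))

-- y is the value at xs, with all witnesses taken from b, which makes the formula Δ₀.
-- Primitive recursion: a set s of pairs, each justified by pairs in s.
-- Minimisation: a set s containing 0 and closed under successor up to y, so
-- that no order on the possibly nonstandard numbers is needed.
-- In repAll, K receives the embedding of the variables into the extended context.
mutual
  rep : PR n → (b y : Fin N) → (Fin n → Fin N) → Formula N
  rep zeroᵖ        b y xs = emptyF y
  rep succᵖ        b y xs = sucF (xs zero) y
  rep (projᵖ i)    b y xs = eql y (xs i)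
  rep (compᵖ f gs) b y xs = repAll gs b xs λ w ys → rep f (w b) (w y) ys
  rep (recᵖ g h)   b y xs =
    bex b (and (opairInF v0 (suc (xs zero)) (suc y))
               (ball v0 (justF g h (suc b) v0 (suc ∘ xs ∘ suc))))
  rep (μᵖ f)       b y xs =
    bex b (and (bex v0 (emptyF v0))
          (and (ball v0 (or (eql v0 (2 ↑ʳ y)) (and (bex v1 (sucF v1 v0))
                                                   (nonzeroF f (2 ↑ʳ b) v0 ((2 ↑ʳ_) ∘ xs)))))
               (bex (suc b) (and (emptyF v0)
                                 (rep f (2 ↑ʳ b) v0 ((2 ↑ʳ y) ∷ᵗ ((2 ↑ʳ_) ∘ xs)))))))

  repAll : ∀ {m} → Vec (PR n) m → (b : Fin N) → (Fin n → Fin N) →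
           (∀ {N′} → (Fin N → Fin N′) → (Fin m → Fin N′) → Formula N′) → Formula N
  repAll []       b xs K = K id λ ()
  repAll (g ∷ gs) b xs K =
    bex b (and (rep g (suc b) v0 (suc ∘ xs))
               (repAll gs (suc b) (suc ∘ xs) λ w ys → K (w ∘ suc) (w v0 ∷ᵗ ys)))

  -- the pair with index 0 is justified by pairs in s
  justF : PR n → PR (2 + n) → (b s : Fin N) → (Fin n → Fin N) → Formula (suc N)
  justF g h b s xs =
    bex (1 ↑ʳ b) (bex (2 ↑ʳ b) (and (opairF v2 v1 v0)
      (or (and (emptyF v1) (rep g (3 ↑ʳ b) v0 ((3 ↑ʳ_) ∘ xs)))
          (bex (3 ↑ʳ b) (bex (4 ↑ʳ b) (and (opairInF (5 ↑ʳ s) v1 v0) (and (sucF v1 v3)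
            (rep h (5 ↑ʳ b) v2 (v1 ∷ᵗ (v0 ∷ᵗ ((5 ↑ʳ_) ∘ xs)))))))))))

  nonzeroF : PR (1 + n) → (b i : Fin N) → (Fin n → Fin N) → Formula N
  nonzeroF f b i xs =
    bex b (bex (1 ↑ʳ b) (and (sucF v0 v1)
      (rep f (2 ↑ʳ b) v1 ((2 ↑ʳ i) ∷ᵗ ((2 ↑ʳ_) ∘ xs)))))

-- Verification of Δ₀ complexity.

emptyF-Δ₀ : (x : Fin N) → IsΔ₀ (emptyF x)
emptyF-Δ₀ x = d-ball x d-fls

adjF-Δ₀ : (s p t : Fin N) → IsΔ₀ (adjF s p t)
adjF-Δ₀ s p t = d-and (d-ball t (d-or (d-mem _ _) (d-eql _ _)))
                      (d-and (d-ball s (d-mem _ _)) (d-mem _ _))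

sucF-Δ₀ : (x y : Fin N) → IsΔ₀ (sucF x y)
sucF-Δ₀ x = adjF-Δ₀ x x

upairF-Δ₀ : (a b c : Fin N) → IsΔ₀ (upairF a b c)
upairF-Δ₀ a b c = d-and (d-ball c (d-or (d-eql _ _) (d-eql _ _))) (d-and (d-mem _ _) (d-mem _ _))

opairF-Δ₀ : (p i v : Fin N) → IsΔ₀ (opairF p i v)
opairF-Δ₀ p i v =
  d-and (d-ball p (d-and (d-mem _ _) (d-ball _ (d-or (d-eql _ _) (d-eql _ _)))))
        (d-and (d-bex p (d-ball _ (d-eql _ _))) (d-bex p (d-mem _ _)))

opairInF-Δ₀ : (s i v : Fin N) → IsΔ₀ (opairInF s i v)
opairInF-Δ₀ s i v = d-bex s (opairF-Δ₀ _ _ _)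

mutual
  rep-Δ₀ : (f : PR n) (b y : Fin N) (xs : Fin n → Fin N) → IsΔ₀ (rep f b y xs)
  rep-Δ₀ zeroᵖ        b y xs = emptyF-Δ₀ y
  rep-Δ₀ succᵖ        b y xs = sucF-Δ₀ _ y
  rep-Δ₀ (projᵖ i)    b y xs = d-eql _ _
  rep-Δ₀ (compᵖ f gs) b y xs = repAll-Δ₀ gs b xs _ λ w ys → rep-Δ₀ f (w b) (w y) ys
  rep-Δ₀ (recᵖ g h)   b y xs =
    d-bex b (d-and (opairInF-Δ₀ _ _ _)
      (d-ball _ (d-bex _ (d-bex _ (d-and (opairF-Δ₀ _ _ _)
        (d-or (d-and (emptyF-Δ₀ _) (rep-Δ₀ g _ _ _))
              (d-bex _ (d-bex _ (d-and (opairInF-Δ₀ _ _ _)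
                (d-and (sucF-Δ₀ _ _) (rep-Δ₀ h _ _ _)))))))))))
  rep-Δ₀ (μᵖ f)       b y xs =
    d-bex b (d-and (d-bex _ (emptyF-Δ₀ _))
            (d-and (d-ball _ (d-or (d-eql _ _)
                     (d-and (d-bex _ (sucF-Δ₀ _ _))
                       (d-bex _ (d-bex _ (d-and (sucF-Δ₀ _ _) (rep-Δ₀ f _ _ _)))))))
                   (d-bex _ (d-and (emptyF-Δ₀ _) (rep-Δ₀ f _ _ _)))))

  repAll-Δ₀ : ∀ {m} (gs : Vec (PR n) m) (b : Fin N) (xs : Fin n → Fin N)
              (K : ∀ {N′} → (Fin N → Fin N′) → (Fin m → Fin N′) → Formula N′) →
              (∀ {N′} (w : Fin N → Fin N′) ys → IsΔ₀ (K w ys)) → IsΔ₀ (repAll gs b xs K)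
  repAll-Δ₀ []       b xs K d = d id λ ()
  repAll-Δ₀ (g ∷ gs) b xs K d =
    d-bex b (d-and (rep-Δ₀ g _ _ _) (repAll-Δ₀ gs _ _ _ λ w ys → d (w ∘ suc) (w v0 ∷ᵗ ys)))

-- d = {n,{n+1,I}}
linkF : (d n I : Fin N) → Formula N
linkF d n I = bex d (bex v0 (and (sucF (2 ↑ʳ n) v0)
                            (and (upairF v0 (2 ↑ʳ I) v1) (upairF (2 ↑ʳ n) v1 (2 ↑ʳ d)))))

-- A weak Δ₀ stand-in for being a natural number. It holds of all standard numerals, and an external
-- induction puts all of them into any set that satisfies it without being a standard numeral.
numberlikeF : Fin N → Formula N
numberlikeF n = and (or (emptyF n) (bex n (emptyF v0)))
                    (ball n (or (sucF v0 (suc n)) (bex (suc n) (sucF v1 v0))))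

linkF-Δ₀ : (d n I : Fin N) → IsΔ₀ (linkF d n I)
linkF-Δ₀ d n I = d-bex d (d-bex v0 (d-and (sucF-Δ₀ _ _) (d-and (upairF-Δ₀ _ _ _) (upairF-Δ₀ _ _ _))))

numberlikeF-Δ₀ : (n : Fin N) → IsΔ₀ (numberlikeF n)
numberlikeF-Δ₀ n = d-and (d-or (emptyF-Δ₀ n) (d-bex n (emptyF-Δ₀ _)))
                         (d-ball n (d-or (sucF-Δ₀ _ _) (d-bex _ (sucF-Δ₀ _ _))))

rename-Δ₀ : ∀ {m} (r : Fin n → Fin m) {φ} → IsΔ₀ φ → IsΔ₀ (rename r φ)
rename-Δ₀ r (d-mem i j)  = d-mem _ _
rename-Δ₀ r (d-eql i j)  = d-eql _ _
rename-Δ₀ r d-fls        = d-fls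
rename-Δ₀ r (d-and d e)  = d-and (rename-Δ₀ r d) (rename-Δ₀ r e)
rename-Δ₀ r (d-or d e)   = d-or (rename-Δ₀ r d) (rename-Δ₀ r e)
rename-Δ₀ r (d-imp d e)  = d-imp (rename-Δ₀ r d) (rename-Δ₀ r e)
rename-Δ₀ r (d-ball i d) = d-ball (r i) (rename-Δ₀ (ext r) d)
rename-Δ₀ r (d-bex i d)  = d-bex (r i) (rename-Δ₀ (ext r) d)

-- Partial recursive programs for constants, Boolean connectives and search.

constᵖ : ℕ → PR n
constᵖ zero    = zeroᵖ
constᵖ (suc k) = compᵖ succᵖ (constᵖ k ∷ [])

notᵖ : PR 1
notᵖ = recᵖ (constᵖ 1) zeroᵖ

andᵖ : PR 2
andᵖ = recᵖ zeroᵖ (projᵖ v2)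

e-const : ∀ k {xs : Vec ℕ n} → Eval (constᵖ k) xs k
e-const zero    = e-zero
e-const (suc k) = e-comp (e-const k ∷ []) e-succ

e-not : ∀ b → Eval notᵖ ((if b then 1 else 0) ∷ []) (if b then 0 else 1)
e-not false = e-rec0 (e-const 1)
e-not true  = e-recS (e-rec0 (e-const 1)) e-zero

e-and : ∀ a b → Eval andᵖ ((if a then 1 else 0) ∷ (if b then 1 else 0) ∷ []) (if a ∧ b then 1 else 0)
e-and false b = e-rec0 e-zero
e-and true  b = e-recS (e-rec0 e-zero) e-proj

least : (P : ℕ → Bool) → ∀ n → P n ≡ true → Σ ℕ λ k → P k ≡ true × (∀ j → j < k → P j ≡ false)
least P n Pn = [ (λ none → n , Pn , none) , id ]′ (scan n)
  where
  scan : ∀ n → (∀ j → j < n → P j ≡ false) ⊎ (Σ ℕ λ k → P k ≡ true × (∀ j → j < k → P j ≡ false))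
  scan zero = inj₁ λ _ ()
  scan (suc n) with scan n
  ... | inj₂ found = inj₂ found
  ... | inj₁ none with P n in eq
  ...   | true  = inj₂ (n , eq , none)
  ...   | false = inj₁ λ j j<1+n → [ none j , (λ { refl → eq }) ]′ (m<1+n⇒m<n∨m≡n j<1+n)

e-search : {t : PR (suc n)} {xs : Vec ℕ n} (P : ℕ → Bool) →
           (∀ y → Eval t (y ∷ xs) (if P y then 0 else 1)) → ∀ n → P n ≡ true →
           Σ ℕ λ y → P y ≡ true × Eval (μᵖ t) xs y
e-search {t = t} {xs} P h n Pn =
  let k , Pk , none = least P n Pn in
  k , Pk , e-μ (subst (λ b → Eval t (k ∷ xs) (if b then 0 else 1)) Pk (h k))
               (λ j j<k → 0 , subst (λ b → Eval t (j ∷ xs) (if b then 0 else 1)) (none j j<k) (h j))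

Evaluates : PR 2 → (ℕ → ℕ → ℕ) → Set
Evaluates p f = ∀ y x → Eval p (y ∷ x ∷ []) (f y x)

Decides : PR 2 → (ℕ → ℕ → Bool) → Set
Decides t P = Evaluates t λ y x → if P y x then 1 else 0

-- `μᵖ` stops at the value 0 while `Decides` codes truth as 1, hence the `notᵖ`.
searchᵖ : PR 2 → PR 2 → PR 1
searchᵖ t u = μᵖ (compᵖ notᵖ (compᵖ andᵖ (t ∷ u ∷ []) ∷ []))

-- The given `y` only guarantees termination. The search stops at its own least witness, which later
-- has to be identified from the two tests alone.
e-searchᵖ : ∀ {t u P Q x} → Decides t P → Decides u Q → ∀ y → P y x ≡ true → Q y x ≡ true →
            Σ ℕ λ y′ → (P y′ x ≡ true) × (Q y′ x ≡ true) × Eval (searchᵖ t u) (x ∷ []) y′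
e-searchᵖ {P = P} {Q} {x} ht hu y Py Qy =
  let y′ , PQ , e = e-search (λ y → P y x ∧ Q y x)
                      (λ y → e-comp (e-comp (ht y x ∷ hu y x ∷ []) (e-and _ _) ∷ []) (e-not _))
                      y (cong₂ _∧_ Py Qy)
  in y′ , ∧-true₁ PQ , ∧-true₂ (P y′ x) PQ , e
  where
  ∧-true₁ : ∀ {a b} → a ∧ b ≡ true → a ≡ true
  ∧-true₁ {true} _ = refl
  ∧-true₂ : ∀ a {b} → a ∧ b ≡ true → b ≡ true
  ∧-true₂ true h = h

¬¬-stable : Stable (¬ A)
¬¬-stable = negated-stable

-- Satisfaction in the quotient structure.

module SetModel (Mem Eq : ℕ → ℕ → Set) (Eq-equiv : IsEquivalence Eq)
  (Mem-cong : ∀ {x x′ y y′} → Eq x x′ → Eq y y′ → Mem x y → Mem x′ y′) where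

  infix 4 _∈_ _≈_
  infix 3 _⊨_

  _∈_ _≈_ : ℕ → ℕ → Set
  x ∈ y = ¬ ¬ Mem x y
  x ≈ y = ¬ ¬ Eq x y

  _⊨_ : (Fin n → ℕ) → Formula n → Set
  ρ ⊨ φ = Sat Mem Eq ρ φ

  ε₀ : Fin 0 → ℕ
  ε₀ ()

  ∃ᶜ : (ℕ → Set) → Set
  ∃ᶜ P = ¬ (∀ a → ¬ P a)

  ∃∈ : ℕ → (ℕ → Set) → Set
  ∃∈ x P = ¬ (∀ a → a ∈ x → ¬ P a)

  un∃ : ∀ {P} → ∃ᶜ P → ¬ ¬ Σ ℕ P
  un∃ h k = h λ a p → k (a , p)

  un∃∈ : ∀ {x P} → ∃∈ x P → ¬ ¬ Σ ℕ λ a → a ∈ x × P a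
  un∃∈ h k = h λ a m p → k (a , m , p)

  some : ∀ {P} a → P a → ∃ᶜ P
  some a p h = h a p

  some∈ : ∀ {x P} a → a ∈ x → P a → ∃∈ x P
  some∈ a m p h = h a m p

  ≈-refl : ∀ {x} → x ≈ x
  ≈-refl = return (IsEquivalence.refl Eq-equiv)

  ≈-sym : ∀ {x y} → x ≈ y → y ≈ x
  ≈-sym p = p >>= λ e → return (IsEquivalence.sym Eq-equiv e)

  ≈-trans : ∀ {x y z} → x ≈ y → y ≈ z → x ≈ z
  ≈-trans p q = p >>= λ e → q >>= λ f → return (IsEquivalence.trans Eq-equiv e f)

  ∈-resp : ∀ {x x′ y y′} → x ≈ x′ → y ≈ y′ → x ∈ y → x′ ∈ y′
  ∈-resp p q m = p >>= λ e → q >>= λ f → m >>= λ g → return (Mem-cong e f g)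

  ∈-respˡ : ∀ {x x′ y} → x ≈ x′ → x ∈ y → x′ ∈ y
  ∈-respˡ p = ∈-resp p ≈-refl

  ∈-respʳ : ∀ {x y y′} → y ≈ y′ → x ∈ y → x ∈ y′
  ∈-respʳ = ∈-resp ≈-refl

  -- Atoms are double-negated and ∨, ∃ are negations, and the other connectives preserve stability.
  -- Thus classical reasoning is available for goals such as `IsSuc` that are formulas but not
  -- literally negations.
  sat-stable : (φ : Formula n) {ρ : Fin n → ℕ} → Stable (ρ ⊨ φ)
  sat-stable (mem i j)  h = ¬¬-stable h
  sat-stable (eql i j)  h = ¬¬-stable h
  sat-stable fls        h = h id
  sat-stable (and φ ψ)  h = sat-stable φ (λ k → h (k ∘ proj₁)) , sat-stable ψ (λ k → h (k ∘ proj₂))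
  sat-stable (or φ ψ)   h = ¬¬-stable h
  sat-stable (imp φ ψ)  h p = sat-stable ψ λ k → h λ f → k (f p)
  sat-stable (all φ)    h a = sat-stable φ λ k → h λ f → k (f a)
  sat-stable (ex φ)     h = ¬¬-stable h
  sat-stable (ball i φ) h a m = sat-stable φ λ k → h λ f → k (f a m)
  sat-stable (bex i φ)  h = ¬¬-stable h

  ∷-≈ : ∀ {m} {r : Fin n → Fin m} {σ ρ} → (∀ i → σ i ≈ ρ (r i)) →
        ∀ a i → (a ∷ᵉ σ) i ≈ (a ∷ᵉ ρ) (ext r i)
  ∷-≈ h a zero    = ≈-refl
  ∷-≈ h a (suc i) = h i

  -- Matching environments only up to `≈` lets one induction give both the renaming lemma and
  -- invariance under the congruence. Both directions go together because `imp` is contravariant.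
  sat-rename : ∀ {m} (φ : Formula n) {r : Fin n → Fin m} {σ ρ} → (∀ i → σ i ≈ ρ (r i)) →
               (σ ⊨ φ → ρ ⊨ rename r φ) × (ρ ⊨ rename r φ → σ ⊨ φ)
  sat-rename (mem i j) h = ∈-resp (h i) (h j) , ∈-resp (≈-sym (h i)) (≈-sym (h j))
  sat-rename (eql i j) h = (λ e → ≈-trans (≈-sym (h i)) (≈-trans e (h j))) ,
                           (λ e → ≈-trans (h i) (≈-trans e (≈-sym (h j))))
  sat-rename fls       h = id , id
  sat-rename (and φ ψ) h =
    let φ→ , φ← = sat-rename φ h ; ψ→ , ψ← = sat-rename ψ h in
    (λ (p , q) → φ→ p , ψ→ q) , (λ (p , q) → φ← p , ψ← q)
  sat-rename (or φ ψ)  h =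
    let φ→ , φ← = sat-rename φ h ; ψ→ , ψ← = sat-rename ψ h in
    (λ k (p , q) → k (p ∘ φ→ , q ∘ ψ→)) , (λ k (p , q) → k (p ∘ φ← , q ∘ ψ←))
  sat-rename (imp φ ψ) h =
    let φ→ , φ← = sat-rename φ h ; ψ→ , ψ← = sat-rename ψ h in
    (λ k → ψ→ ∘ k ∘ φ←) , (λ k → ψ← ∘ k ∘ φ→)
  sat-rename (all φ)   h =
    (λ k a → proj₁ (sat-rename φ (∷-≈ h a)) (k a)) , (λ k a → proj₂ (sat-rename φ (∷-≈ h a)) (k a))
  sat-rename (ex φ)    h =
    (λ k l → k λ a → l a ∘ proj₁ (sat-rename φ (∷-≈ h a))) ,
    (λ k l → k λ a → l a ∘ proj₂ (sat-rename φ (∷-≈ h a)))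
  sat-rename (ball i φ) h =
    (λ k a m → proj₁ (sat-rename φ (∷-≈ h a)) (k a (∈-respʳ (≈-sym (h i)) m))) ,
    (λ k a m → proj₂ (sat-rename φ (∷-≈ h a)) (k a (∈-respʳ (h i) m)))
  sat-rename (bex i φ) h =
    (λ k l → k λ a m → l a (∈-respʳ (h i) m) ∘ proj₁ (sat-rename φ (∷-≈ h a))) ,
    (λ k l → k λ a m → l a (∈-respʳ (≈-sym (h i)) m) ∘ proj₂ (sat-rename φ (∷-≈ h a)))

  sat-resp : (φ : Formula n) {σ ρ : Fin n → ℕ} → (∀ i → σ i ≈ ρ i) → σ ⊨ φ → ρ ⊨ φ
  sat-resp φ h = proj₂ (sat-rename φ {id} λ _ → ≈-refl) ∘ proj₁ (sat-rename φ h)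

  -- The predicates from here to `OPair` are definitionally the satisfaction of the corresponding
  -- formulas, so `sat-resp` and `sat-stable` apply to them directly.
  Empty : ℕ → Set
  Empty x = ∀ a → a ∈ x → ⊥

  Adj : (s p t : ℕ) → Set
  Adj s p t = (∀ a → a ∈ t → a ∈ s ∨ᶜ a ≈ p) × (∀ a → a ∈ s → a ∈ t) × p ∈ t

  IsSuc : (x y : ℕ) → Set
  IsSuc x = Adj x x

  UPair : (a b c : ℕ) → Set
  UPair a b c = (∀ x → x ∈ c → x ≈ a ∨ᶜ x ≈ b) × a ∈ c × b ∈ c

  OPair : (p i v : ℕ) → Set
  OPair p i v = (∀ e → e ∈ p → i ∈ e × (∀ x → x ∈ e → x ≈ i ∨ᶜ x ≈ v)) ×
                ∃∈ p (λ e → ∀ x → x ∈ e → x ≈ i) × ∃∈ p (λ e → v ∈ e)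

  Inductive : ℕ → Set
  Inductive I = ∃∈ I Empty × (∀ x → x ∈ I → ∃∈ I (IsSuc x))

  -- The common ground of the two theories: separation only for Δ₀ formulas, as in KP, and
  -- replacement only for functional ones, as in ZFC.
  record Theory : Set where
    field
      extensionality : ∀ {x y} → (∀ a → (a ∈ x → a ∈ y) × (a ∈ y → a ∈ x)) → x ≈ y
      regularity : ∀ {a z} → z ∈ a → ∃∈ a λ x → ∀ y → y ∈ x → ¬ y ∈ a
      pairing    : ∀ x y → ∃ᶜ λ c → x ∈ c × y ∈ c
      union      : ∀ x → ∃ᶜ λ u → ∀ a → a ∈ x → ∀ w → w ∈ a → w ∈ u
      infinity   : ∃ᶜ Inductive
      separation : ∀ {n} {φ : Formula (suc n)} → IsΔ₀ φ → ∀ ρ a →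
        ∃ᶜ λ b → ∀ x → (x ∈ b → x ∈ a × (x ∷ᵉ ρ ⊨ φ)) × (x ∈ a × (x ∷ᵉ ρ ⊨ φ) → x ∈ b)
      replacement : ∀ {n} {φ : Formula (suc (suc n))} → IsΔ₀ φ → ∀ ρ a →
        (∀ x → x ∈ a → ∃ᶜ λ y → (y ∷ᵉ (x ∷ᵉ ρ) ⊨ φ) × (∀ y′ → y′ ∷ᵉ (x ∷ᵉ ρ) ⊨ φ → y′ ≈ y)) →
        ∃ᶜ λ b → ∀ x → x ∈ a → ∃∈ b λ y → y ∷ᵉ (x ∷ᵉ ρ) ⊨ φ

  -- The first argument is an external number, the second an element of the model; only standard von
  -- Neumann numerals are described.
  IsNum : ℕ → ℕ → Set
  IsNum zero    x = Empty x
  IsNum (suc n) y = ∃ᶜ λ x → IsNum n x × IsSuc x y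

  Nums : Vec ℕ n → (Fin n → ℕ) → Set
  Nums ns vs = ∀ i → IsNum (lookup ns i) (vs i)

  IsNum-stable : ∀ n {x} → Stable (IsNum n x)
  IsNum-stable zero    h a m = h λ e → e a m
  IsNum-stable (suc n) h = ¬¬-stable h

  IsSuc-resp : ∀ {x x′ y y′} → x ≈ x′ → y ≈ y′ → IsSuc x y → IsSuc x′ y′
  IsSuc-resp {x} {x′} {y} {y′} p q =
    sat-resp (sucF v0 v1) {x ∷ᵉ (y ∷ᵉ ε₀)} {x′ ∷ᵉ (y′ ∷ᵉ ε₀)} λ { v0 → p ; v1 → q }

  IsNum-resp : ∀ n {x y} → x ≈ y → IsNum n x → IsNum n y
  IsNum-resp zero    p h a m = h a (∈-respʳ (≈-sym p) m)
  IsNum-resp (suc n) p h = do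
    (x , hx , s) ← un∃ h
    some x (hx , IsSuc-resp ≈-refl p s)

  -- Elementary set theory and the standard numerals.

  module Numerals (T : Theory) where
    open Theory T

    Adj-unique : ∀ {s p t t′} → Adj s p t → Adj s p t′ → t ≈ t′
    Adj-unique {s} {p} h h′ = extensionality λ a → sub h h′ a , sub h′ h a
      where
      sub : ∀ {t t′} → Adj s p t → Adj s p t′ → ∀ a → a ∈ t → a ∈ t′
      sub (e , _) (_ , i , m) a a∈t =
        ∨ᶜ-elim (e a a∈t) (λ a∈s → i a a∈s) (λ a≈p → ∈-respˡ (≈-sym a≈p) m)

    UPair-unique : ∀ {a b c c′} → UPair a b c → UPair a b c′ → c ≈ c′
    UPair-unique {a} {b} h h′ = extensionality λ x → sub h h′ x , sub h′ h x
      where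
      sub : ∀ {c c′} → UPair a b c → UPair a b c′ → ∀ x → x ∈ c → x ∈ c′
      sub (e , _) (_ , ma , mb) x x∈c =
        ∨ᶜ-elim (e x x∈c) (λ p → ∈-respˡ (≈-sym p) ma) (λ p → ∈-respˡ (≈-sym p) mb)

    Empty-unique : ∀ {x y} → Empty x → Empty y → x ≈ y
    Empty-unique hx hy = extensionality λ a → (⊥-elim ∘ hx a) , (⊥-elim ∘ hy a)

    num-unique : ∀ n {x y} → IsNum n x → IsNum n y → x ≈ y
    num-unique zero    hx hy = Empty-unique hx hy
    num-unique (suc n) hx hy = do
      (x′ , hx′ , sx) ← un∃ hx
      (y′ , hy′ , sy) ← un∃ hy
      Adj-unique (IsSuc-resp (num-unique n hx′ hy′) ≈-refl sx) sy

    infixr 4 _∪ᶜ_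
    _∪ᶜ_ : ∀ s c → ∃ᶜ λ u → (∀ a → a ∈ s → a ∈ u) × (∀ a → a ∈ c → a ∈ u)
    s ∪ᶜ c = do
      (d , s∈d , c∈d) ← un∃ (pairing s c)
      (u , h) ← un∃ (union d)
      some u (h s s∈d , h c c∈d)

    adjoin : ∀ s p → ∃ᶜ (Adj s p)
    adjoin s p = do
      (c , p∈c , _) ← un∃ (pairing p p)
      (u , s⊆u , c⊆u) ← un∃ (s ∪ᶜ c)
      (t , h) ← un∃ (separation (d-or (d-mem v0 v1) (d-eql v0 v2)) (s ∷ᵉ (p ∷ᵉ ε₀)) u)
      some t ((λ a m → proj₂ (proj₁ (h a) m)) ,
              (λ a m → proj₂ (h a) (s⊆u a m , inl m)) ,
              proj₂ (h p) (c⊆u p p∈c , inr ≈-refl))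

    empty : ∃ᶜ Empty
    empty = do
      (I , h , _) ← un∃ infinity
      (z , _ , hz) ← un∃∈ h
      some z hz

    upair : ∀ a b → ∃ᶜ (UPair a b)
    upair a b = do
      (z , hz) ← un∃ empty
      (s , es , _ , a∈s) ← un∃ (adjoin z a)
      (t , et , s⊆t , b∈t) ← un∃ (adjoin s b)
      some t ((λ x m → ∨ᶜ-elim (et x m) (λ x∈s → ∨ᶜ-elim (es x x∈s) (λ k → ⊥-elim (hz x k)) inl) inr) ,
              s⊆t a a∈s , b∈t)

    -- Regularity for {x, y}: a minimal element would be x or y, yet each contains the other.
    no-2-cycle : ∀ {x y} → x ∈ y → ¬ y ∈ x
    no-2-cycle {x} {y} x∈y y∈x = un∃ (upair x y) λ (c , e , x∈c , y∈c) →
      un∃∈ (regularity x∈c) λ (z , z∈c , h) →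
      e z z∈c ((λ z≈x → h y (∈-respʳ (≈-sym z≈x) y∈x) y∈c) ,
               (λ z≈y → h x (∈-respʳ (≈-sym z≈y) x∈y) x∈c))

    irrefl : ∀ {x} → ¬ x ∈ x
    irrefl h = no-2-cycle h h

    -- If the predecessors differed, each would be an element of the other.
    suc-injective : ∀ {x x′ y} → IsSuc x y → IsSuc x′ y → x ≈ x′
    suc-injective (e , _ , x∈y) (e′ , _ , x′∈y) =
      ∨ᶜ-elim (e′ _ x∈y)
        (λ x∈x′ → ∨ᶜ-elim (e _ x′∈y) (λ x′∈x → ⊥-elim (no-2-cycle x∈x′ x′∈x)) ≈-sym) id

    num-exists : ∀ n → ∃ᶜ (IsNum n)
    num-exists zero    = empty
    num-exists (suc n) = do
      (x , hx) ← un∃ (num-exists n)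
      (y , s) ← un∃ (adjoin x x)
      some y (some x (hx , s))

    num-pred : ∀ n {x y} → IsNum (suc n) y → IsSuc x y → IsNum n x
    num-pred n h s = IsNum-stable n do
      (x′ , hx′ , s′) ← un∃ h
      return (IsNum-resp n (suc-injective s′ s) hx′)

    num-suc : ∀ n {x y} → IsNum n x → IsNum (suc n) y → IsSuc x y
    num-suc n {x} {y} hx hy = sat-stable (sucF v0 v1) {x ∷ᵉ (y ∷ᵉ ε₀)} do
      (x′ , hx′ , s) ← un∃ hy
      return (IsSuc-resp (num-unique n hx′ hx) ≈-refl s)

    -- The induction is on the external `n`, so it is sound even in an ill-founded model.
    num-elements : ∀ n {x y} → IsNum n y → x ∈ y → ¬ ¬ Σ ℕ λ j → j < n × IsNum j x
    num-elements zero    h m = ⊥-elim (h _ m)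
    num-elements (suc n) h m = do
      (y′ , hy′ , e , _) ← un∃ h
      ∨ᶜ-elim (e _ m)
        (λ m′ → do
          (j , j<n , hj) ← num-elements n hy′ m′
          return (j , m<n⇒m<1+n j<n , hj))
        (λ x≈y′ → return (n , n<1+n n , IsNum-resp n (≈-sym x≈y′) hy′))

    num-mem : ∀ {j n x y} → j < n → IsNum j x → IsNum n y → x ∈ y
    num-mem {j} {suc n} j<n hx hy = do
      (y′ , hy′ , s) ← un∃ hy
      [ (λ j<n′ → proj₁ (proj₂ s) _ (num-mem j<n′ hx hy′))
        , (λ { refl → ∈-respˡ (num-unique n hy′ hx) (proj₂ (proj₂ s)) }) ]′ (m<1+n⇒m<n∨m≡n j<n)

    num∈Inductive : ∀ {I} → Inductive I → ∀ n {x} → IsNum n x → x ∈ I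
    num∈Inductive (base , _) zero hx = do
      (z , z∈I , hz) ← un∃∈ base
      ∈-respˡ (Empty-unique hz hx) z∈I
    num∈Inductive ind@(_ , step) (suc n) hx = do
      (x′ , hx′ , s) ← un∃ hx
      (y , y∈I , s′) ← un∃∈ (step x′ (num∈Inductive ind n hx′))
      ∈-respˡ (Adj-unique s′ s) y∈I

    opair : ∀ i v → ∃ᶜ λ p → OPair p i v
    opair i v = do
      (c , ec , i∈c , _) ← un∃ (upair i i)
      (d , ed , i∈d , v∈d) ← un∃ (upair i v)
      (p , ep , c∈p , d∈p) ← un∃ (upair c d)
      some p (
        (λ e e∈p →
          (∨ᶜ-elim (ep e e∈p) (λ e≈c → ∈-respʳ (≈-sym e≈c) i∈c) (λ e≈d → ∈-respʳ (≈-sym e≈d) i∈d)) ,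
          (λ x x∈e → ∨ᶜ-elim (ep e e∈p)
            (λ e≈c → inl (∨ᶜ-elim (ec x (∈-respʳ e≈c x∈e)) id id))
            (λ e≈d → ed x (∈-respʳ e≈d x∈e)))) ,
        some∈ c c∈p (λ x x∈c → ∨ᶜ-elim (ec x x∈c) id id) ,
        some∈ d d∈p v∈d)

    -- The member of `p` with `i` as its only element also contains `j`, which settles the first
    -- components.
    opair-injective : ∀ {p i v j w} → OPair p i v → OPair p j w → i ≈ j × v ≈ w
    opair-injective {i = i} {v} {j} {w} (a , s , d) (a′ , s′ , d′) = i≈j , v≈w
      where
      i≈j : i ≈ j
      i≈j = do
        (e , e∈p , h) ← un∃∈ s
        ≈-sym (h j (proj₁ (a′ e e∈p)))
      v≈w : v ≈ w
      v≈w = do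
        (e , e∈p , v∈e) ← un∃∈ d
        (e′ , e′∈p , w∈e′) ← un∃∈ d′
        ∨ᶜ-elim (proj₂ (a′ e e∈p) v v∈e)
          -- If `v ≈ j` and `w ≈ i`, then all four components coincide, by `i ≈ j`.
          (λ v≈j → ∨ᶜ-elim (proj₂ (a e′ e′∈p) w w∈e′)
             (λ w≈i → ≈-trans v≈j (≈-trans (≈-sym i≈j) (≈-sym w≈i))) ≈-sym)
          id

    OPair-resp : ∀ {p p′ i i′ v v′} → p ≈ p′ → i ≈ i′ → v ≈ v′ → OPair p i v → OPair p′ i′ v′
    OPair-resp {p} {p′} {i} {i′} {v} {v′} e f g =
      sat-resp (opairF v0 v1 v2) {p ∷ᵉ (i ∷ᵉ (v ∷ᵉ ε₀))} {p′ ∷ᵉ (i′ ∷ᵉ (v′ ∷ᵉ ε₀))}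
        λ { v0 → e ; v1 → f ; v2 → g }

    -- Closure is demanded only at numerals below `k`, because the set certifying a minimisation may
    -- stop at its value.
    climb : ∀ k {s} → ∃∈ s Empty →
            (∀ j → j < k → ∀ {i} → IsNum j i → i ∈ s → ∃∈ s (IsSuc i)) → ∃∈ s (IsNum k)
    climb zero    base step = base
    climb (suc k) base step = do
      (i , i∈s , hi) ← un∃∈ (climb k base λ j j<k → step j (m<n⇒m<1+n j<k))
      (i′ , i′∈s , si) ← un∃∈ (step k (n<1+n k) hi i∈s)
      some∈ i′ i′∈s (some i (hi , si))

    -- Soundness: certificates in the model force the correct value.

    mutual
      -- Induction on the evaluation. The bound is arbitrary: a certificate may have nonstandard
      -- parts, but at standard arguments it is forced to follow the actual computation.
      sound : (f : PR n) → ∀ {ns m} → Eval f ns m → (ρ : Fin N → ℕ) (b y : Fin N)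
              (xs : Fin n → Fin N) → Nums ns (ρ ∘ xs) → ρ ⊨ rep f b y xs → IsNum m (ρ y)
      sound zeroᵖ     e-zero ρ b y xs hs h = h
      sound succᵖ     (e-succ {x}) ρ b y xs hs h = some (ρ (xs zero)) (hs zero , h)
      sound (projᵖ i) {ns} e-proj ρ b y xs hs h = IsNum-resp (lookup ns i) (≈-sym h) (hs i)
      sound (compᵖ f gs) {m = m} (e-comp es e) ρ b y xs hs h = IsNum-stable m
        (soundAll gs es ρ b xs _ hs h λ ρ′ w ys ρ′≡ρ hys k →
          return (subst (IsNum m) (ρ′≡ρ y) (sound f e ρ′ (w b) (w y) ys hys k)))
      sound (recᵖ g h) {_ ∷ _} {m} e ρ b y xs hs r = IsNum-stable m do
        (s , _ , p , j) ← un∃∈ r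
        return (soundRec g h e (s ∷ᵉ ρ) (suc b) v0 (suc ∘ xs ∘ suc) (hs ∘ suc) j (hs zero) p)
      sound (μᵖ f) {ns} {k} (e-μ e es) ρ b y xs hs r = IsNum-stable k do
        (s , _ , base , closed , last) ← un∃∈ r
        (z , _ , hz , rz) ← un∃∈ last
        -- Below `k` the function is nonzero, so by induction the value `z` claimed at `y` would be
        -- a successor numeral, but `z` is empty.
        let not-early : ∀ j → j < k → ¬ IsNum j (ρ y)
            not-early j j<k hy =
              un∃ (sound f (proj₂ (es j j<k)) (z ∷ᵉ (s ∷ᵉ ρ)) (2 ↑ʳ b) v0 _
                     (λ { zero → hy ; (suc i) → hs i }) rz)
                  λ (u , _ , su) → hz u (proj₂ (proj₂ su))
        -- Hence `s` is closed under successor below `k` and contains the numeral `k`. If that is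
        -- not `y`, the certificate claims a nonzero value at `k`, where `f` gives 0.
        (i , i∈s , hi) ← un∃∈ (climb k base λ j j<k {i} hi i∈s →
          ∨ᶜ-elim (closed i i∈s)
            (λ i≈y → ⊥-elim (not-early j j<k (IsNum-resp j i≈y hi))) proj₁)
        ∨ᶜ-elim (closed i i∈s)
          (λ i≈y → return (IsNum-resp k i≈y hi))
          (λ (_ , nonzero) → do
            (v , _ , h) ← un∃∈ nonzero
            (u , _ , suv , rv) ← un∃∈ h
            ⊥-elim (sound f e (u ∷ᵉ (v ∷ᵉ (i ∷ᵉ (s ∷ᵉ ρ)))) (4 ↑ʳ b) v1 _
                      (λ { zero → hi ; (suc q) → hs q }) rv u (proj₂ (proj₂ suv))))

      -- Continuation-passing mirrors `repAll`: the continuation receives the environment extended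
      -- by the intermediate values and its agreement with `ρ` along `w`.
      soundAll : ∀ {m} (gs : Vec (PR n) m) {ns ms} → EvalAll gs ns ms →
        (ρ : Fin N → ℕ) (b : Fin N) (xs : Fin n → Fin N)
        (K : ∀ {N′} → (Fin N → Fin N′) → (Fin m → Fin N′) → Formula N′) →
        Nums ns (ρ ∘ xs) → ρ ⊨ repAll gs b xs K →
        (∀ {N′} (ρ′ : Fin N′ → ℕ) w ys → (∀ i → ρ′ (w i) ≡ ρ i) → Nums ms (ρ′ ∘ ys) →
          ρ′ ⊨ K w ys → ¬ B) → ¬ B
      soundAll []       []       ρ b xs K hs h c = c ρ id (λ ()) (λ _ → refl) (λ ()) h
      soundAll (g ∷ gs) {ms = m ∷ _} (e ∷ es) ρ b xs K hs h c = do
        (y , _ , hg , hgs) ← un∃∈ h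
        let hy = sound g e (y ∷ᵉ ρ) (suc b) v0 (suc ∘ xs) hs hg
        soundAll gs es (y ∷ᵉ ρ) (suc b) (suc ∘ xs) _ hs hgs λ ρ′ w ys ρ′≡ρ hys →
          c ρ′ (w ∘ suc) (w v0 ∷ᵗ ys) (ρ′≡ρ ∘ suc)
            λ { zero → subst (IsNum m) (sym (ρ′≡ρ v0)) hy ; (suc i) → hys i }

      -- A pair with index `k` can only be justified by the clause matching `k`, since an empty
      -- index has no predecessor. The predecessor pair lies in the same set and is settled by
      -- induction.
      soundRec : (g : PR n) (h : PR (2 + n)) → ∀ {k ns m} → Eval (recᵖ g h) (k ∷ ns) m →
        (ρ : Fin N → ℕ) (b s : Fin N) (xs : Fin n → Fin N) → Nums ns (ρ ∘ xs) →
        ρ ⊨ ball s (justF g h b s xs) →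
        ∀ {x y} → IsNum k x → ∃∈ (ρ s) (λ p → OPair p x y) → IsNum m y
      soundRec g h {m = m} (e-rec0 e) ρ b s xs hs j hx r = IsNum-stable m do
        (p , p∈s , op) ← un∃∈ r
        (i , _ , jv) ← un∃∈ (j p p∈s)
        (v , _ , op′ , q) ← un∃∈ jv
        let i≈x , v≈y = opair-injective op′ op
        ∨ᶜ-elim q
          (λ (_ , rg) → return (IsNum-resp m v≈y
            (sound g e (v ∷ᵉ (i ∷ᵉ (p ∷ᵉ ρ))) (3 ↑ʳ b) v0 ((3 ↑ʳ_) ∘ xs) hs rg)))
          (λ r′ → do
            (j′ , _ , r″) ← un∃∈ r′
            (_ , _ , _ , (_ , _ , j′∈i) , _) ← un∃∈ r″
            ⊥-elim (hx j′ (∈-respʳ i≈x j′∈i)))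
      soundRec g h {suc k} {m = m} (e-recS e e′) ρ b s xs hs j hx r = IsNum-stable m do
        (p , p∈s , op) ← un∃∈ r
        (i , _ , jv) ← un∃∈ (j p p∈s)
        (v , _ , op′ , q) ← un∃∈ jv
        let i≈x , v≈y = opair-injective op′ op
        ∨ᶜ-elim q
          (λ (i-empty , _) → do
            (x′ , _ , _ , _ , x′∈x) ← un∃ hx
            ⊥-elim (i-empty x′ (∈-respʳ (≈-sym i≈x) x′∈x)))
          (λ r′ → do
            (j′ , _ , r″) ← un∃∈ r′
            (u , _ , q′ , sj , rh) ← un∃∈ r″
            let hj = num-pred k (IsNum-resp (suc k) (≈-sym i≈x) hx) sj
                hu = soundRec g h e ρ b s xs hs j hj q′
            return (IsNum-resp m v≈y
              (sound h e′ (u ∷ᵉ (j′ ∷ᵉ (v ∷ᵉ (i ∷ᵉ (p ∷ᵉ ρ))))) (5 ↑ʳ b) v2 _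
                (λ { zero → hj ; (suc zero) → hu ; (suc (suc q)) → hs q }) rh)))

    -- Completeness: sufficiently large bounds contain certificates.

    _⊆_ : ℕ → ℕ → Set
    β ⊆ b = ∀ a → a ∈ β → a ∈ b

    -- A filter of bounds: finitely many demands are met by one union of sets, without a proof that
    -- `rep` is monotone in its bound.
    Eventually : (ℕ → Set) → Set
    Eventually P = ∃ᶜ λ β → ∀ b → β ⊆ b → P b

    always : ∀ P → (∀ b → P b) → Eventually P
    always P h = un∃ empty >>= λ (z , _) → some z λ b _ → h b

    ev-map : ∀ {P} Q → (∀ b → P b → Q b) → Eventually P → Eventually Q
    ev-map Q f p = un∃ p >>= λ (β , h) → some β λ b s → f b (h b s)

    ev-× : ∀ {P Q} → Eventually P → Eventually Q → Eventually λ b → P b × Q b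
    ev-× p q = do
      (β , h) ← un∃ p
      (γ , k) ← un∃ q
      (u , β⊆u , γ⊆u) ← un∃ (β ∪ᶜ γ)
      some u λ b u⊆b → h b (λ a → u⊆b a ∘ β⊆u a) , k b (λ a → u⊆b a ∘ γ⊆u a)

    ev-∈ : ∀ x → Eventually (x ∈_)
    ev-∈ x = un∃ (pairing x x) >>= λ (c , x∈c , _) → some c λ b c⊆b → c⊆b x x∈c

    ev-∀< : ∀ k {P : ℕ → ℕ → Set} → (∀ j → j < k → Eventually (P j)) →
            Eventually λ b → ∀ j → j < k → P j b
    ev-∀< zero    h = always _ λ _ _ ()
    ev-∀< (suc k) {P} h =
      ev-map _ (λ b (p , q) j j<1+k →
               [ p j , (λ j≡k → subst (λ i → P i b) (sym j≡k) q) ]′ (m<1+n⇒m<n∨m≡n j<1+k))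
             (ev-× (ev-∀< k λ j j<k → h j (m<n⇒m<1+n j<k)) (h k (n<1+n k)))

    -- The bound is fixed as an element `β`, not as a variable: under binders its index shifts while
    -- the element stays the same.
    Represented : PR n → Vec ℕ n → ℕ → ℕ → Set
    Represented {n} f ns m β = ∀ {N} (ρ : Fin N → ℕ) b y (xs : Fin n → Fin N) → ρ b ≡ β →
      Nums ns (ρ ∘ xs) → IsNum m (ρ y) → ρ ⊨ rep f b y xs

    RepresentedAll : ∀ {m} → Vec (PR n) m → Vec ℕ n → Vec ℕ m → ℕ → Set
    RepresentedAll {n} {m} gs ns ms β = ∀ {N} (ρ : Fin N → ℕ) b (xs : Fin n → Fin N)
      (K : ∀ {N′} → (Fin N → Fin N′) → (Fin m → Fin N′) → Formula N′) → ρ b ≡ β →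
      Nums ns (ρ ∘ xs) →
      (∀ {N′} (ρ′ : Fin N′ → ℕ) w ys → (∀ i → ρ′ (w i) ≡ ρ i) → Nums ms (ρ′ ∘ ys) → ρ′ ⊨ K w ys) →
      ρ ⊨ repAll gs b xs K

    -- Every superset `ρ t` is allowed, so earlier pairs stay justified when a new pair is adjoined.
    Justified : PR n → PR (2 + n) → Vec ℕ n → ℕ → ℕ → Set
    Justified {n} g h ns s β = ∀ {N} (ρ : Fin N → ℕ) b t (xs : Fin n → Fin N) → ρ b ≡ β →
      s ⊆ ρ t → Nums ns (ρ ∘ xs) → ∀ p → p ∈ s → p ∷ᵉ ρ ⊨ justF g h b t xs

    Nonzero : PR (1 + n) → Vec ℕ n → ℕ → ℕ → Set
    Nonzero {n} f ns j β = ∀ {N} (ρ : Fin N → ℕ) b i (xs : Fin n → Fin N) → ρ b ≡ β →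
      Nums ns (ρ ∘ xs) → IsNum j (ρ i) → ρ ⊨ nonzeroF f b i xs

    ∈-≡ : ∀ {x b β} → b ≡ β → x ∈ β → x ∈ b
    ∈-≡ {x} b≡β = subst (x ∈_) (sym b≡β)

    mutual
      complete : (f : PR n) → ∀ {ns m} → Eval f ns m → Eventually (Represented f ns m)
      complete zeroᵖ     {ns} e-zero = always (Represented zeroᵖ ns 0) λ _ ρ b y xs _ hs hy → hy
      complete succᵖ     {ns} (e-succ {x}) = always (Represented succᵖ ns (suc x)) λ _ ρ b y xs _ hs hy →
        num-suc x (hs zero) hy
      complete (projᵖ i) {ns} e-proj = always (Represented (projᵖ i) ns (lookup ns i)) λ _ ρ b y xs _ hs hy →
        num-unique (lookup ns i) hy (hs i)
      complete (compᵖ f gs) {ns} {m} (e-comp es e) =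
        ev-map (Represented (compᵖ f gs) ns m)
               (λ β (hf , hgs) ρ b y xs eq hs hy →
                 hgs ρ b xs _ eq hs λ ρ′ w ys ρ′≡ρ hys →
                   hf ρ′ (w b) (w y) ys (trans (ρ′≡ρ b) eq) hys (subst (IsNum m) (sym (ρ′≡ρ y)) hy))
               (ev-× (complete f e) (completeAll gs es))
      complete (recᵖ g h) {k ∷ ns} {m} e = do
        (s , hp , hj) ← un∃ (completeRec g h e)
        ev-map (Represented (recᵖ g h) (k ∷ ns) m)
               (λ β (j , s∈β) ρ b y xs eq hs hy →
                 some∈ s (∈-≡ eq s∈β) (hp _ _ (hs zero) hy ,
                   j (s ∷ᵉ ρ) (suc b) v0 (suc ∘ xs ∘ suc) eq (λ _ → id) (hs ∘ suc)))
               (ev-× hj (ev-∈ s))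
      complete (μᵖ f) {ns} {k} (e-μ e es) = do
        (z , hz) ← un∃ (num-exists 0)
        -- The certificate is the numeral k+1 = {0,...,k}: it contains the successor of every j < k,
        -- and its last member is the value `k`.
        (s , hs) ← un∃ (num-exists (suc k))
        ev-map (Represented (μᵖ f) ns k)
               (λ β ((hf , hnz) , z∈β , s∈β) ρ b y xs eq hxs hy →
                 some∈ s (∈-≡ eq s∈β)
                   ( some∈ z (num-mem {0} {suc k} (s≤s z≤n) hz hs) hz
                   , (λ i i∈s → num-elements (suc k) hs i∈s >>= λ (j , j<1+k , hi) →
                       [ (λ j<k → inr
                           ( (un∃ (num-exists (suc j)) >>= λ (i′ , hi′) →
                                some∈ i′ (num-mem (s≤s j<k) hi′ hs) (num-suc j hi hi′))
                           , hnz j j<k (i ∷ᵉ (s ∷ᵉ ρ)) (2 ↑ʳ b) v0 _ eq hxs hi))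
                       , (λ { refl → inl (num-unique j hi hy) }) ]′ (m<1+n⇒m<n∨m≡n j<1+k))
                   , some∈ z (∈-≡ eq z∈β)
                       (hz , hf (z ∷ᵉ (s ∷ᵉ ρ)) (2 ↑ʳ b) v0 _ eq
                               (λ { zero → hy ; (suc i) → hxs i }) hz)))
               (ev-× (ev-× (complete f e) (ev-∀< k λ j j<k → completeNonzero f (proj₂ (es j j<k))))
                     (ev-× (ev-∈ z) (ev-∈ s)))

      completeNonzero : (f : PR (1 + n)) → ∀ {j ns v} → Eval f (j ∷ ns) (suc v) →
                        Eventually (Nonzero f ns j)
      completeNonzero f {j} {ns} {v} e = do
        (y , hy) ← un∃ (num-exists (suc v))
        (x , hx , s) ← un∃ hy
        ev-map (Nonzero f ns j)
               (λ β (hf , y∈β , x∈β) ρ b i xs eq hs hi →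
                 some∈ y (∈-≡ eq y∈β) (some∈ x (∈-≡ eq x∈β)
                   (s , hf (x ∷ᵉ (y ∷ᵉ ρ)) (2 ↑ʳ b) v1 _ eq
                          (λ { zero → hi ; (suc q) → hs q }) hy)))
               (ev-× (complete f e) (ev-× (ev-∈ y) (ev-∈ x)))

      completeAll : ∀ {m} (gs : Vec (PR n) m) {ns ms} → EvalAll gs ns ms →
                    Eventually (RepresentedAll gs ns ms)
      completeAll []       {ns} []       = always (RepresentedAll [] ns []) λ _ ρ b xs K _ hs k →
        k ρ id (λ ()) (λ _ → refl) (λ ())
      completeAll (g ∷ gs) {ns} {m ∷ ms} (e ∷ es) = do
        (y , hy) ← un∃ (num-exists m)
        ev-map (RepresentedAll (g ∷ gs) ns (m ∷ ms))
               (λ β ((hg , hgs) , y∈β) ρ b xs K eq hs k →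
                 some∈ y (∈-≡ eq y∈β)
                   ( hg (y ∷ᵉ ρ) (suc b) v0 (suc ∘ xs) eq hs hy
                   , hgs (y ∷ᵉ ρ) (suc b) (suc ∘ xs) _ eq hs λ ρ′ w ys ρ′≡ρ hys →
                       k ρ′ (w ∘ suc) (w v0 ∷ᵗ ys) (ρ′≡ρ ∘ suc)
                         λ { zero → subst (IsNum m) (sym (ρ′≡ρ v0)) hy ; (suc i) → hys i }))
               (ev-× (ev-× (complete g e) (completeAll gs es)) (ev-∈ y))

      -- The set of pairs grows along the recursion, one adjoined pair per stage.
      completeRec : (g : PR n) (h : PR (2 + n)) → ∀ {k ns m} → Eval (recᵖ g h) (k ∷ ns) m →
        ∃ᶜ λ s → (∀ x y → IsNum k x → IsNum m y → ∃∈ s λ p → OPair p x y) ×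
                 Eventually (Justified g h ns s)
      completeRec g h {ns = ns} {m} (e-rec0 e) = do
        (x , hx) ← un∃ (num-exists 0)
        (y , hy) ← un∃ (num-exists m)
        (p , op) ← un∃ (opair x y)
        (s , es , _ , p∈s) ← un∃ (adjoin x p)
        some s
          ( (λ _ _ hx′ hy′ → some∈ p p∈s
              (OPair-resp ≈-refl (num-unique 0 hx hx′) (num-unique m hy hy′) op))
          , ev-map (Justified g h ns s)
                   (λ β (hg , x∈β , y∈β) ρ b t xs eq _ hs p′ p′∈s →
                     ∨ᶜ-elim (es p′ p′∈s) (λ p′∈x → ⊥-elim (hx p′ p′∈x)) λ p′≈p →
                     some∈ x (∈-≡ eq x∈β) (some∈ y (∈-≡ eq y∈β)
                       ( OPair-resp (≈-sym p′≈p) ≈-refl ≈-refl op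
                       , inl (hx , hg (y ∷ᵉ (x ∷ᵉ (p′ ∷ᵉ ρ))) (3 ↑ʳ b) v0 _ eq hs hy))))
                   (ev-× (complete g e) (ev-× (ev-∈ x) (ev-∈ y))))
      completeRec g h {suc k} {ns} {m} (e-recS {r = r} e e′) = do
        (s , hp , hj) ← un∃ (completeRec g h e)
        (x , hx) ← un∃ (num-exists (suc k))
        (x′ , hx′ , sx) ← un∃ hx
        (y , hy) ← un∃ (num-exists m)
        (y′ , hy′) ← un∃ (num-exists r)
        (p , op) ← un∃ (opair x y)
        (t , et , s⊆t , p∈t) ← un∃ (adjoin s p)
        some t
          ( (λ _ _ hx″ hy″ → some∈ p p∈t
              (OPair-resp ≈-refl (num-unique (suc k) hx hx″) (num-unique m hy hy″) op))
          , ev-map (Justified g h ns t)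
                   (λ β ((hh , j) , (x∈β , x′∈β) , (y∈β , y′∈β)) ρ b t′ xs eq t⊆t′ hs p′ p′∈t →
                     ∨ᶜ-elim (et p′ p′∈t)
                       (j ρ b t′ xs eq (λ a → t⊆t′ a ∘ s⊆t a) hs p′) λ p′≈p →
                     some∈ x (∈-≡ eq x∈β) (some∈ y (∈-≡ eq y∈β)
                       ( OPair-resp (≈-sym p′≈p) ≈-refl ≈-refl op
                       , inr (some∈ x′ (∈-≡ eq x′∈β) (some∈ y′ (∈-≡ eq y′∈β)
                           ( (un∃∈ (hp _ _ hx′ hy′) >>= λ (q , q∈s , oq) →
                                some∈ q (t⊆t′ q (s⊆t q q∈s)) oq)
                           , sx
                           , hh (y′ ∷ᵉ (x′ ∷ᵉ (y ∷ᵉ (x ∷ᵉ (p′ ∷ᵉ ρ))))) (5 ↑ʳ b) v2 _ eq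
                               (λ { zero → hx′ ; (suc zero) → hy′ ; (suc (suc q)) → hs q }) hy))))))
                   (ev-× (ev-× (complete h e′) hj)
                         (ev-× (ev-× (ev-∈ x) (ev-∈ x′)) (ev-× (ev-∈ y) (ev-∈ y′)))))

    -- Links from a numeral to the next.

    UPair-resp : ∀ {a a′ b b′ c c′} → a ≈ a′ → b ≈ b′ → c ≈ c′ → UPair a b c → UPair a′ b′ c′
    UPair-resp {a} {a′} {b} {b′} {c} {c′} p q r =
      sat-resp (upairF v0 v1 v2) {a ∷ᵉ (b ∷ᵉ (c ∷ᵉ ε₀))} {a′ ∷ᵉ (b′ ∷ᵉ (c′ ∷ᵉ ε₀))}
        λ { v0 → p ; v1 → q ; v2 → r }

    -- An element of a numeral is a numeral, hence in `I`; so `I` would belong to itself.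
    num∌I : ∀ {I} → Inductive I → ∀ n {x} → IsNum n x → ¬ I ∈ x
    num∌I ind n hx I∈x = num-elements n hx I∈x λ (j , _ , hI) → irrefl (num∈Inductive ind j hI)

    -- The fixed `I` is a marker: membership tests against it tell apart the two elements of d, and
    -- the two elements of {n+1, I}.
    IsLink : (I d n : ℕ) → Set
    IsLink I d n = ∃∈ d λ e → ∃∈ e λ y → IsSuc n y × UPair y I e × UPair n e d

    IsLink-resp : ∀ {I d n n′} → n ≈ n′ → IsLink I d n → IsLink I d n′
    IsLink-resp {I} {d} {n} {n′} p =
      sat-resp (linkF v0 v1 v2) {d ∷ᵉ (n ∷ᵉ (I ∷ᵉ ε₀))} {d ∷ᵉ (n′ ∷ᵉ (I ∷ᵉ ε₀))}
        λ { v0 → ≈-refl ; v1 → p ; v2 → ≈-refl }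

    -- Supplies the functionality that `replacement` asks for.
    IsLink-unique : ∀ {I d d′ n} → IsLink I d n → IsLink I d′ n → d ≈ d′
    IsLink-unique h h′ = do
      (e , _ , k) ← un∃∈ h
      (y , _ , s , u , w) ← un∃∈ k
      (e′ , _ , k′) ← un∃∈ h′
      (y′ , _ , s′ , u′ , w′) ← un∃∈ k′
      let e≈e′ = UPair-unique (UPair-resp (Adj-unique s s′) ≈-refl ≈-refl u) u′
      UPair-unique (UPair-resp ≈-refl e≈e′ ≈-refl w) w′

    links : ∀ {I} → Inductive I →
            ∃ᶜ λ D → (∀ d → d ∈ D → ∃∈ I (IsLink I d)) × (∀ n → n ∈ I → ∃∈ D λ d → IsLink I d n)
    links {I} (_ , step) = do
      (B , hB) ← un∃ (replacement (linkF-Δ₀ v0 v1 v2) (I ∷ᵉ ε₀) I λ n n∈I → do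
        (y , y∈I , s) ← un∃∈ (step n n∈I)
        (e , he) ← un∃ (upair y I)
        (d , hd) ← un∃ (upair n e)
        let l = some∈ e (proj₂ (proj₂ hd)) (some∈ y (proj₁ (proj₂ he)) (s , he , hd))
        some d (l , λ d′ l′ → IsLink-unique {I} {d′} {d} {n} l′ l))
      -- Replacement gives only a superset `B` of the links; stray elements would mislead the search
      -- and are removed.
      (D , hD) ← un∃ (separation (d-bex v1 (linkF-Δ₀ v1 v0 v2)) (I ∷ᵉ ε₀) B)
      some D ( (λ d d∈D → proj₂ (proj₁ (hD d) d∈D))
             , (λ n n∈I → un∃∈ (hB n n∈I) >>= λ (d , d∈B , l) →
                  some∈ d (proj₂ (hD d) (d∈B , some∈ n n∈I l)) l))

    -- A link d of some k, possibly nonstandard, has the elements k and {k+1, I}. A numeral in d is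
    -- not the latter, which contains `I`, so it is k.
    link-of : ∀ {I D} → Inductive I → (∀ d → d ∈ D → ∃∈ I (IsLink I d)) →
              ∀ n {x d} → IsNum n x → d ∈ D → x ∈ d → IsLink I d x
    link-of {I} ind hD n {x} {d} hx d∈D x∈d = do
      (k , _ , l) ← un∃∈ (hD d d∈D)
      (e , _ , l′) ← un∃∈ l
      (y , _ , _ , (_ , _ , I∈e) , (ed , _)) ← un∃∈ l′
      ∨ᶜ-elim (ed x x∈d) (λ x≈k → IsLink-resp {I} {d} {k} {x} (≈-sym x≈k) l)
        (λ x≈e → ⊥-elim (num∌I ind n hx (∈-respʳ (≈-sym x≈e) I∈e)))

    link-upper : ∀ {I} → Inductive I → ∀ n {x d e} → IsNum n x → IsLink I d x → e ∈ d → I ∈ e →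
                 ∃ᶜ λ y → IsNum (suc n) y × UPair y I e
    link-upper ind n {x} {d} {e} hx l e∈d I∈e = do
      (e′ , _ , l′) ← un∃∈ l
      (y , _ , s , u , (ed , _)) ← un∃∈ l′
      ∨ᶜ-elim (ed e e∈d) (λ e≈x → ⊥-elim (num∌I ind n hx (∈-respʳ e≈x I∈e)))
        (λ e≈e′ → some y (some x (hx , s) , UPair-resp ≈-refl ≈-refl (≈-sym e≈e′) u))

    upper-num : ∀ {I e} n → (∃ᶜ λ y → IsNum (suc n) y × UPair y I e) →
                ∀ {y} → y ∈ e → y ∈ I → IsNum (suc n) y
    upper-num n h {y} y∈e y∈I = do
      (y′ , hy′ , (ee , _)) ← un∃ h
      ∨ᶜ-elim (ee y y∈e) (λ y≈y′ → IsNum-resp (suc n) (≈-sym y≈y′) hy′)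
        (λ y≈I → ⊥-elim (irrefl (∈-respˡ y≈I y∈I)))

    -- Coding computable sets by elements of the model.

    -- The two Σ₁ properties may overlap; at each standard numeral `S` only chooses one that holds.
    -- In this form both theories provide it.
    Σ₁-Separation : Set
    Σ₁-Separation = ∀ {θ₀ θ₁ : Formula 2} → IsΔ₀ θ₀ → IsΔ₀ θ₁ →
      (∀ n x → IsNum n x → ∃ᶜ λ b → b ∷ᵉ (x ∷ᵉ ε₀) ⊨ or θ₀ θ₁) →
      ∃ᶜ λ S → ∀ n x → IsNum n x →
        (x ∈ S → ∃ᶜ λ b → b ∷ᵉ (x ∷ᵉ ε₀) ⊨ θ₁) × (¬ x ∈ S → ∃ᶜ λ b → b ∷ᵉ (x ∷ᵉ ε₀) ⊨ θ₀)

    -- The properties say that some bound certifies an empty, respectively nonempty, value.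
    -- Completeness shows that one of them holds, and soundness that any certificate tells the
    -- truth.
    computable⇒set : Σ₁-Separation → (f : PR 1) → (∀ n → ∃ᶜ λ m → Eval f (n ∷ []) m) →
      ∃ᶜ λ S → ∀ n x → IsNum n x →
        (x ∈ S → ¬ Eval f (n ∷ []) 0) × (¬ x ∈ S → ∀ m → ¬ Eval f (n ∷ []) (suc m))
    computable⇒set separate f f-total = do
      (S , hS) ← un∃ (separate
        (d-bex v0 (d-and (emptyF-Δ₀ v0) (rep-Δ₀ f _ _ _)))
        (d-bex v0 (d-and (d-imp (emptyF-Δ₀ v0) d-fls) (rep-Δ₀ f _ _ _))) total)
      some S λ n x hx →
        (λ x∈S e →
          un∃ (proj₁ (hS n x hx) x∈S) λ (b , h) →
          un∃∈ h λ (y , _ , y-nonempty , r) →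
          y-nonempty (sound f e (y ∷ᵉ (b ∷ᵉ (x ∷ᵉ ε₀))) v1 v0 _ (λ { v0 → hx }) r)) ,
        (λ x∉S m e →
          un∃ (proj₂ (hS n x hx) x∉S) λ (b , h) →
          un∃∈ h λ (y , _ , y-empty , r) →
          un∃ (sound f e (y ∷ᵉ (b ∷ᵉ (x ∷ᵉ ε₀))) v1 v0 _ (λ { v0 → hx }) r)
            λ (w , _ , _ , _ , w∈y) → y-empty w w∈y)
      where
      zeroF oneF : Formula 2
      zeroF = bex v0 (and (emptyF v0) (rep f v1 v0 λ _ → v2))
      oneF  = bex v0 (and (neg (emptyF v0)) (rep f v1 v0 λ _ → v2))

      total : ∀ n x → IsNum n x → ∃ᶜ λ b → b ∷ᵉ (x ∷ᵉ ε₀) ⊨ or zeroF oneF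
      total n x hx = do
        (m , e) ← un∃ (f-total n)
        (y , hy) ← un∃ (num-exists m)
        -- The bound also contains the value `y`, so the emptiness of `y` decides between the two
        -- formulas.
        (b , h) ← un∃ (ev-× (complete f e) (ev-∈ y))
        let r , y∈b = h b (λ _ → id)
            s = r (y ∷ᵉ (b ∷ᵉ (x ∷ᵉ ε₀))) v1 v0 (λ _ → v2) refl (λ { v0 → hx }) hy
        some b λ (not-zero , not-one) →
          not-one (some∈ y y∈b ((λ y-empty → not-zero (some∈ y y∈b (y-empty , s))) , s))

  -- The common theory derived from the axioms.

  keep1-≈ : ∀ {x b a} {ρ : Fin n → ℕ} i → (x ∷ᵉ ρ) i ≈ (x ∷ᵉ (b ∷ᵉ (a ∷ᵉ ρ))) (keep1 2 i)
  keep1-≈ zero    = ≈-refl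
  keep1-≈ (suc i) = ≈-refl

  keep2-1-≈ : ∀ {y x a} {ρ : Fin n → ℕ} i →
              (y ∷ᵉ (x ∷ᵉ ρ)) i ≈ (y ∷ᵉ (x ∷ᵉ (a ∷ᵉ ρ))) (keep2 1 i)
  keep2-1-≈ zero          = ≈-refl
  keep2-1-≈ (suc zero)    = ≈-refl
  keep2-1-≈ (suc (suc i)) = ≈-refl

  keep2-2-≈ : ∀ {y x b a} {ρ : Fin n → ℕ} i →
              (y ∷ᵉ (x ∷ᵉ ρ)) i ≈ (y ∷ᵉ (x ∷ᵉ (b ∷ᵉ (a ∷ᵉ ρ)))) (keep2 2 i)
  keep2-2-≈ zero          = ≈-refl
  keep2-2-≈ (suc zero)    = ≈-refl
  keep2-2-≈ (suc (suc i)) = ≈-refl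

  keepR-≈ : ∀ {y′ y x a} {ρ : Fin n → ℕ} i →
            (y′ ∷ᵉ (x ∷ᵉ ρ)) i ≈ (y′ ∷ᵉ (y ∷ᵉ (x ∷ᵉ (a ∷ᵉ ρ)))) (keepR i)
  keepR-≈ zero          = ≈-refl
  keepR-≈ (suc zero)    = ≈-refl
  keepR-≈ (suc (suc i)) = ≈-refl

  Ax-Sep-elim : (φ : Formula (suc n)) (ρ : Fin n → ℕ) → ρ ⊨ Ax-Sep φ → ∀ a →
    ∃ᶜ λ b → ∀ x → (x ∈ b → x ∈ a × (x ∷ᵉ ρ ⊨ φ)) × (x ∈ a × (x ∷ᵉ ρ ⊨ φ) → x ∈ b)
  Ax-Sep-elim φ ρ h a = do
    (b , hb) ← un∃ (h a)
    some b λ x →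
      (λ x∈b → let x∈a , p = proj₁ (hb x) x∈b in x∈a , proj₂ (sat-rename φ keep1-≈) p) ,
      (λ (x∈a , p) → proj₂ (hb x) (x∈a , proj₁ (sat-rename φ keep1-≈) p))

  Ax-Coll-elim : (φ : Formula (suc (suc n))) (ρ : Fin n → ℕ) → ρ ⊨ Ax-Coll φ → ∀ a →
    (∀ x → x ∈ a → ∃ᶜ λ y → y ∷ᵉ (x ∷ᵉ ρ) ⊨ φ) →
    ∃ᶜ λ b → ∀ x → x ∈ a → ∃∈ b λ y → y ∷ᵉ (x ∷ᵉ ρ) ⊨ φ
  Ax-Coll-elim φ ρ h a tot = do
    (b , hb) ← un∃ (h a λ x x∈a → do
      (y , p) ← un∃ (tot x x∈a)
      some y (proj₁ (sat-rename φ keep2-1-≈) p))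
    some b λ x x∈a → do
      (y , y∈b , p) ← un∃∈ (hb x x∈a)
      some∈ y y∈b (proj₂ (sat-rename φ keep2-2-≈) p)

  Ax-Repl-elim : (φ : Formula (suc (suc n))) (ρ : Fin n → ℕ) → ρ ⊨ Ax-Repl φ → ∀ a →
    (∀ x → x ∈ a → ∃ᶜ λ y → (y ∷ᵉ (x ∷ᵉ ρ) ⊨ φ) × (∀ y′ → y′ ∷ᵉ (x ∷ᵉ ρ) ⊨ φ → y′ ≈ y)) →
    ∃ᶜ λ b → ∀ x → x ∈ a → ∃∈ b λ y → y ∷ᵉ (x ∷ᵉ ρ) ⊨ φ
  Ax-Repl-elim φ ρ h a tot = do
    (b , hb) ← un∃ (h a λ x x∈a → do
      (y , p , unique) ← un∃ (tot x x∈a)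
      some y (proj₁ (sat-rename φ keep2-1-≈) p ,
              λ y′ p′ → unique y′ (proj₂ (sat-rename φ keepR-≈) p′)))
    some b λ x x∈a → do
      (y , y∈b , p) ← un∃∈ (hb x x∈a)
      some∈ y y∈b (proj₂ (sat-rename φ keep2-2-≈) p)

  Ax-Inf-elim : ε₀ ⊨ Ax-Inf → ∃ᶜ Inductive
  Ax-Inf-elim h = do
    (I , base , step) ← un∃ h
    some I (base , λ x x∈I → do
      (y , y∈I , x∈y , x⊆y , y⊆) ← un∃∈ (step x x∈I)
      some∈ y y∈I (y⊆ , x⊆y , x∈y))

  zfc-theory : IsModelOf ZFC Mem Eq → Theory
  zfc-theory M = record
    { extensionality = M _ zfc-ext ε₀ _ _
    ; regularity     = λ {a} {z} z∈a → M _ zfc-reg ε₀ a (some∈ z z∈a id)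
    ; pairing        = M _ zfc-pair ε₀
    ; union          = M _ zfc-union ε₀
    ; infinity       = Ax-Inf-elim (M _ zfc-inf ε₀)
    ; separation     = λ {_} {φ} _ ρ → Ax-Sep-elim φ ρ (M _ (zfc-sep φ) ρ)
    ; replacement    = λ {_} {φ} _ ρ → Ax-Repl-elim φ ρ (M _ (zfc-repl φ) ρ)
    }

  kp-theory : IsModelOf KP Mem Eq → Theory
  kp-theory M = record
    { extensionality = M _ kp-ext ε₀ _ _
    -- Regularity is the instance of the foundation scheme for membership in `a`.
    ; regularity     = λ {a} {z} z∈a →
        un∃ (M _ (kp-found (mem v0 v1)) (a ∷ᵉ ε₀) (some z z∈a)) >>= λ (x , x∈a , h) → some∈ x x∈a h
    ; pairing        = M _ kp-pair ε₀
    ; union          = M _ kp-union ε₀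
    ; infinity       = Ax-Inf-elim (M _ kp-inf ε₀)
    ; separation     = λ {_} {φ} d ρ → Ax-Sep-elim φ ρ (M _ (kp-sep φ d) ρ)
    ; replacement    = λ {_} {φ} d ρ a tot → Ax-Coll-elim φ ρ (M _ (kp-coll φ d) ρ) a
        λ x x∈a → un∃ (tot x x∈a) >>= λ (y , p , _) → some y p
    }

  -- Separating Σ₁ properties in ZFC and in KP.

  -- Full separation applies to the unbounded `ex θ₁`; at a numeral outside the resulting set,
  -- totality leaves only `θ₀`.
  zfc-separation : (M : IsModelOf ZFC Mem Eq) → Numerals.Σ₁-Separation (zfc-theory M)
  zfc-separation M {θ₀} {θ₁} _ _ tot = do
    (I , ind) ← un∃ infinity
    (S , hS) ← un∃ (Ax-Sep-elim (ex θ₁) ε₀ (M _ (zfc-sep (ex θ₁)) ε₀) I)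
    some S λ n x hx →
      (λ x∈S → proj₂ (proj₁ (hS x) x∈S)) ,
      (λ x∉S → un∃ (tot n x hx) >>= λ (b , h) →
        ∨ᶜ-elim h (some b) λ p → ⊥-elim (x∉S (proj₂ (hS x) (num∈Inductive ind n hx , some b p))))
    where
    open Theory (zfc-theory M)
    open Numerals (zfc-theory M)

  -- Either every element of ω, or every element of some nonstandard n ∈ ω, has a
  -- witness: take n to be ∈-minimal without one. Collection then bounds the witnesses.
  module _ (M : IsModelOf KP Mem Eq) where
    open Theory (kp-theory M)
    open Numerals (kp-theory M)

    Numberlike : ℕ → Set
    Numberlike n = Empty n ∨ᶜ ∃∈ n Empty × (∀ x → x ∈ n → IsSuc x n ∨ᶜ ∃∈ n (IsSuc x))

    num-numberlike : ∀ n {x} → IsNum n x → Numberlike x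
    num-numberlike zero    hx = inl hx , λ a a∈x → ⊥-elim (hx a a∈x)
    num-numberlike (suc n) {x} hx = sat-stable (numberlikeF v0) {x ∷ᵉ ε₀} do
      (y , hy , s@(e , y⊆x , y∈x)) ← un∃ hx
      let z , c = num-numberlike n hy
      return ( inr (∨ᶜ-elim z (some∈ y y∈x) λ h → do
                 (a , a∈y , ha) ← un∃∈ h
                 some∈ a (y⊆x a a∈y) ha)
             , λ a a∈x → ∨ᶜ-elim (e a a∈x)
                 (λ a∈y → inr (∨ᶜ-elim (c a a∈y) (some∈ y y∈x) λ h → do
                    (b , b∈y , hb) ← un∃∈ h
                    some∈ b (y⊆x b b∈y) hb))
                 (λ a≈y → inl (IsSuc-resp (≈-sym a≈y) ≈-refl s)))

    -- External induction: the successor of a standard numeral in `n` is standard, so it is not `n`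
    -- itself and must lie in `n`.
    nums⊆nonstandard : ∀ {n} → Numberlike n → (∀ k → ¬ IsNum k n) → ∀ k {x} → IsNum k x → x ∈ n
    nums⊆nonstandard (z , _) ns zero hx =
      ∨ᶜ-elim z (λ e → ⊥-elim (ns 0 e)) λ h → do
        (a , a∈n , ha) ← un∃∈ h
        ∈-respˡ (Empty-unique ha hx) a∈n
    nums⊆nonstandard nl@(_ , c) ns (suc k) hx = do
      (y , hy , s) ← un∃ hx
      ∨ᶜ-elim (c y (nums⊆nonstandard nl ns k hy))
        (λ s′ → ⊥-elim (ns (suc k) (some y (hy , s′)))) λ h → do
          (a , a∈n , s′) ← un∃∈ h
          ∈-respˡ (Adj-unique s′ s) a∈n

    weaken-≈ : ∀ {b x c} i → (b ∷ᵉ (x ∷ᵉ ε₀)) i ≈ (b ∷ᵉ (x ∷ᵉ (c ∷ᵉ ε₀))) (i ↑ˡ 1)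
    weaken-≈ v0 = ≈-refl
    weaken-≈ v1 = ≈-refl

    overspill : (θ : Formula 2) → (∀ n x → IsNum n x → ∃ᶜ λ b → b ∷ᵉ (x ∷ᵉ ε₀) ⊨ θ) →
      ∃ᶜ λ N → (∀ n x → IsNum n x → x ∈ N) × (∀ x → x ∈ N → ∃ᶜ λ b → b ∷ᵉ (x ∷ᵉ ε₀) ⊨ θ)
    overspill θ tot = un∃ infinity >>= λ (I , ind) goal →
      let
        inωF = and (mem v0 v1) (numberlikeF v0)

        -- This formula has an unbounded quantifier, so its minimal instance comes from the full
        -- foundation scheme.
        badF : Formula 2
        badF = and inωF (neg (ex (rename (_↑ˡ 1) θ)))

        -- Here `a` will be `I` or a minimal bad number. Not being bad yields a witness only where
        -- `inωF` holds, so `a` is first cut down by `inωF`.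
        from : ∀ a → (∀ n x → IsNum n x → x ∈ a) → (∀ x → x ∈ a → ¬ (x ∷ᵉ (I ∷ᵉ ε₀) ⊨ badF)) → ⊥
        from a nums good =
          un∃ (separation (d-and (d-mem v0 v1) (numberlikeF-Δ₀ v0)) (I ∷ᵉ ε₀) a) λ (N , hN) →
            goal N
              ( (λ n x hx → proj₂ (hN x)
                  (nums n x hx , num∈Inductive ind n hx , num-numberlike n hx))
              , λ x x∈N k → let x∈a , p = proj₁ (hN x) x∈N in
                  good x x∈a (p , λ h → h λ b q → k b (proj₂ (sat-rename θ weaken-≈) q)))
      in
      from I (λ n x → num∈Inductive ind n) λ x _ bad →
      M _ (kp-found badF) (I ∷ᵉ ε₀) (some x bad) λ n (((n∈I , nl) , none) , minimal) →
      from n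
        (λ k x → nums⊆nonstandard nl
          (λ j hn → none (un∃ (tot j n hn) >>= λ (b , p) →
            some b (proj₁ (sat-rename θ weaken-≈) p))) k)
        λ m m∈n bad′ → minimal m m∈n (proj₁ (sat-rename badF keep1-1-≈) bad′)
      where
      keep1-1-≈ : ∀ {m n I} i → (m ∷ᵉ (I ∷ᵉ ε₀)) i ≈ (m ∷ᵉ (n ∷ᵉ (I ∷ᵉ ε₀))) (keep1 1 i)
      keep1-1-≈ v0 = ≈-refl
      keep1-1-≈ v1 = ≈-refl

    kp-separation : Σ₁-Separation
    kp-separation {θ₀} {θ₁} d₀ d₁ tot = do
      (N , nums , witness) ← un∃ (overspill (or θ₀ θ₁) tot)
      (B , hB) ← un∃ (Ax-Coll-elim (or θ₀ θ₁) ε₀ (M _ (kp-coll _ (d-or d₀ d₁)) ε₀) N witness)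
      -- With witnesses confined to the parameter `B`, the Σ₁ property becomes Δ₀.
      (S , hS) ← un∃ (separation (d-bex v1 (rename-Δ₀ (_↑ˡ 1) d₁)) (B ∷ᵉ ε₀) N)
      some S λ n x hx →
        (λ x∈S → do
          (b , _ , p) ← un∃∈ (proj₂ (proj₁ (hS x) x∈S))
          some b (proj₂ (sat-rename θ₁ weaken-≈) p)) ,
        (λ x∉S → do
          (b , b∈B , h) ← un∃∈ (hB x (nums n x hx))
          ∨ᶜ-elim h (some b) λ p → ⊥-elim (x∉S (proj₂ (hS x)
            (nums n x hx , some∈ b b∈B (proj₁ (sat-rename θ₁ weaken-≈) p)))))

-- Computing numerals, and the diagonal argument.

module Diagonal (ε : ℕ → ℕ → Bool) (E : ℕ → ℕ → Set)
  (E-equiv : IsEquivalence E) (E-cong : IsCongruence ε E) (comp : Computable₂ ε) where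

  open SetModel (λ x y → ε x y ≡ true) E E-equiv (λ p q → proj₁ (E-cong p q)) public

  c : PR 2
  c = proj₁ comp

  -- The bridge from classical membership to computation: `ε` is Boolean, so the double negation can
  -- be removed.
  decode : ∀ {x y} → x ∈ y → ε x y ≡ true
  decode {x} {y} = decidable-stable (ε x y ≟ true)

  decides-ε : ∀ {p q f g} → Evaluates p f → Evaluates q g →
              Decides (compᵖ c (p ∷ q ∷ [])) (λ y x → ε (f y x) (g y x))
  decides-ε hp hq y x = e-comp (hp y x ∷ hq y x ∷ []) (proj₂ comp _ _)

  module _ (T : Theory) (separate : Numerals.Σ₁-Separation T) where
    open Theory T
    open Numerals T

    module _ {I D : ℕ} (ind : Inductive I) (D-links : ∀ d → d ∈ D → ∃∈ I (IsLink I d))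
             (D-total : ∀ n → n ∈ I → ∃∈ D λ d → IsLink I d n) {z : ℕ} (z-empty : Empty z) where

      -- In each test variable 0 is the candidate and variable 1 the input. The sets `I` and `D`
      -- enter as numerical constants.
      linkᵖ upperᵖ memberᵖ : PR 1
      linkᵖ   = searchᵖ (compᵖ c (projᵖ v0 ∷ constᵖ D ∷ [])) (compᵖ c (projᵖ v1 ∷ projᵖ v0 ∷ []))
      upperᵖ  = searchᵖ (compᵖ c (projᵖ v0 ∷ projᵖ v1 ∷ [])) (compᵖ c (constᵖ I ∷ projᵖ v0 ∷ []))
      memberᵖ = searchᵖ (compᵖ c (projᵖ v0 ∷ projᵖ v1 ∷ [])) (compᵖ c (projᵖ v0 ∷ constᵖ I ∷ []))

      -- Computes one representative of each numeral; which one depends on the searches, and `E` is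
      -- never consulted.
      numeralᵖ : PR 1
      numeralᵖ = recᵖ (constᵖ z)
        (compᵖ memberᵖ (compᵖ upperᵖ (compᵖ linkᵖ (projᵖ v1 ∷ []) ∷ []) ∷ []))

      e-var₀ : Evaluates (projᵖ v0) λ y x → y
      e-var₀ _ _ = e-proj

      e-var₁ : Evaluates (projᵖ v1) λ y x → x
      e-var₁ _ _ = e-proj

      -- The link provided by `D-total` makes the search halt, and `link-of` identifies whatever it
      -- finds. The next two lemmas follow the same pattern.
      e-linkᵖ : ∀ n {x} → IsNum n x → ∃ᶜ λ d → IsLink I d x × Eval linkᵖ (x ∷ []) d
      e-linkᵖ n {x} hx = do
        (d , d∈D , l) ← un∃∈ (D-total x (num∈Inductive ind n hx))
        (_ , _ , l′) ← un∃∈ l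
        (_ , _ , _ , _ , _ , x∈d , _) ← un∃∈ l′
        let d′ , d′∈D , x∈d′ , e = e-searchᵖ (decides-ε e-var₀ (λ _ _ → e-const D))
                                     (decides-ε e-var₁ e-var₀) d (decode d∈D) (decode x∈d)
        some d′ (link-of ind D-links n hx (return d′∈D) (return x∈d′) , e)

      e-upperᵖ : ∀ n {x d} → IsNum n x → IsLink I d x →
                 ∃ᶜ λ e → (∃ᶜ λ y → IsNum (suc n) y × UPair y I e) × Eval upperᵖ (d ∷ []) e
      e-upperᵖ n {x} {d} hx l = do
        (e , e∈d , l′) ← un∃∈ l
        (_ , _ , _ , (_ , _ , I∈e) , _) ← un∃∈ l′
        let e′ , e′∈d , I∈e′ , ev = e-searchᵖ (decides-ε e-var₀ e-var₁)
                                      (decides-ε (λ _ _ → e-const I) e-var₀) e (decode e∈d) (decode I∈e)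
        some e′ (link-upper ind n hx l (return e′∈d) (return I∈e′) , ev)

      e-memberᵖ : ∀ n {e} → (∃ᶜ λ y → IsNum (suc n) y × UPair y I e) →
                  ∃ᶜ λ y → IsNum (suc n) y × Eval memberᵖ (e ∷ []) y
      e-memberᵖ n {e} h = do
        (y , hy , _ , y∈e , _) ← un∃ h
        let y′ , y′∈e , y′∈I , ev = e-searchᵖ (decides-ε e-var₀ e-var₁)
              (decides-ε e-var₀ (λ _ _ → e-const I)) y (decode y∈e)
              (decode (num∈Inductive ind (suc n) hy))
        some y′ (upper-num n h (return y′∈e) (return y′∈I) , ev)

      e-numeralᵖ : ∀ n → ∃ᶜ λ x → IsNum n x × Eval numeralᵖ (n ∷ []) x
      e-numeralᵖ zero = some z (z-empty , e-rec0 (e-const z))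
      e-numeralᵖ (suc n) = do
        (x , hx , ev) ← un∃ (e-numeralᵖ n)
        (d , l , ed) ← un∃ (e-linkᵖ n hx)
        (e , u , ee) ← un∃ (e-upperᵖ n hx l)
        (y , hy , ey) ← un∃ (e-memberᵖ n u)
        some y (hy , e-recS ev (e-comp (e-comp (e-comp (e-proj ∷ []) ed ∷ []) ee ∷ []) ey))

      -- The input is used both as the index of a numeral and as an element of the model.
      diagᵖ : PR 1
      diagᵖ = compᵖ notᵖ (compᵖ c (numeralᵖ ∷ projᵖ v0 ∷ []) ∷ [])

      e-diagᵖ : ∀ {n x} → Eval numeralᵖ (n ∷ []) x → Eval diagᵖ (n ∷ []) (if ε x n then 0 else 1)
      e-diagᵖ e = e-comp (e-comp (e ∷ e-proj ∷ []) (proj₂ comp _ _) ∷ []) (e-not _)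

      -- S codes n ↦ ¬ ε(n̄,n) at all standard n; it is refuted at n = S.
      contradiction : ⊥
      contradiction =
        un∃ (computable⇒set separate diagᵖ λ n →
               un∃ (e-numeralᵖ n) >>= λ (x , _ , e) → some _ (e-diagᵖ e)) λ (S , hS) →
        un∃ (e-numeralᵖ S) λ (x , hx , e) →
        let inside , outside = hS S x hx in
        refute (e-diagᵖ e) inside outside
        where
        refute : ∀ {S x} → Eval diagᵖ (S ∷ []) (if ε x S then 0 else 1) →
                 (x ∈ S → ¬ Eval diagᵖ (S ∷ []) 0) →
                 (¬ x ∈ S → ∀ m → ¬ Eval diagᵖ (S ∷ []) (suc m)) → ⊥
        refute {S} {x} e inside outside with ε x S
        ... | true  = inside (λ k → k refl) e
        ... | false = outside (λ x∈S → x∈S λ ()) 0 e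

    inconsistent : ⊥
    inconsistent =
      un∃ infinity λ (I , ind) →
      un∃ (links ind) λ (D , D-links , D-total) →
      un∃ empty λ (z , z-empty) →
      contradiction ind D-links D-total z-empty

theorem9 : ¬ ComputableQuotientModel ZFC × ¬ ComputableQuotientModel KP
theorem9 =
  (λ (ε , E , comp , equiv , cong , M) →
    let open Diagonal ε E equiv cong comp in inconsistent (zfc-theory M) (zfc-separation M)) ,
  (λ (ε , E , comp , equiv , cong , M) →
    let open Diagonal ε E equiv cong comp in inconsistent (kp-theory M) (kp-separation M))
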